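{- Let $a,b\ge1$, $P=[a]\times[b]$, $n=a+b$. For $1\le i\le a$, $1\le j\le b$ and $1\le k\le n-1$ define functionals on $(\mathbb R^+)^P$ by $$F_{i,j}(f)=\log\bigl(f(i,j)\,f(a+1-i,b+1-j)\bigr),\qquad F_k(f)=\log\Bigl(\prod_{(i,j)\in P:\ j-i=k-a}f(i,j)\Bigr).$$ Each of these functionals is $0$-mesic under $\rho_{\mathcal B}$ and under $\pi_{\mathcal B}$: for each such $F$, each $T\in\{\rho_{\mathcal B},\pi_{\mathcal B}\}$ and every $f\in(\mathbb R^+)^P$, $\sum_{m=0}^{n-1}F(T^m(f))=0$.
   Context: $[a]\times[b]=\{(i,j)\in\mathbb Z^2:1\le i\le a,\ 1\le j\le b\}$ with the product order. Let $\widehat P=P\cup\{\hat0,\hat1\}$ with $\hat0<x<\hat1$ for all $x\in P$; write $y\lessdot x$ for covering relations; $x^+=\{y\in\widehat P:y\gtrdot x\}$, $x^-=\{y\in\widehat P:y\lessdot x\}$. Each $f:P\to\mathbb R^+$ is extended by $\hat f(\hat0)=\hat f(\hat1)=1$. Parallel sum: $s_1\parallel\cdots\parallel s_m=(1/s_1+\cdots+1/s_m)^{ -1}$. The birational toggle $\tau_x$ changes only the value at $x$: $(\tau_xf)(x)=\frac{1}{f(x)}\bigl(\sum_{y\in x^- }\hat f(y)\bigr)\bigl(\|_{y\in x^+}\hat f(y)\bigr)$. Birational rowmotion $\rho_{\mathcal B}=\tau_{x_1}\circ\cdots\circ\tau_{x_p}$ for any linear extension $x_1,\dots,x_p$ of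 $P$. The $k$-th file is $\{(i,j)\in P:j-i+a=k\}$; $\tau^*_k$ is the composition of the toggles over file $k$; birational promotion $\pi_{\mathcal B}=\tau^*_{n-1}\circ\cdots\circ\tau^*_1$. Both maps satisfy $T^n=\mathrm{id}$ on $(\mathbb R^+)^P$. -}

module Defs where

open import Level using (_⊔_) renaming (suc to lsuc; zero to lzero)
open import Algebra.Bundles using (CommutativeRing)
open import Algebra.Apartness.Structures using (IsHeytingField)
import Algebra.Definitions.RawMonoid as RawMonoidDefinitions
import Algebra.Properties.CommutativeMonoid.Sum as Summation
import Algebra.Properties.Ring as RingProperties
open import Data.Empty using (⊥-elim)
open import Data.Fin.Base as Fin using (Fin; toℕ; opposite)
import Data.Fin.Properties as Fin
open import Data.List.Base as List
  using (List; []; _∷_; allFin; cartesianProduct; filter; foldr; downFrom)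
open import Data.List.Membership.Propositional using (_∈_)
open import Data.List.Membership.Propositional.Properties
  using (∈-allFin; ∈-cartesianProduct⁺; ∈-map⁺; ∈-filter⁺)
open import Data.List.NonEmpty as List⁺ using (List⁺; _∷_; foldr₁)
open import Data.List.Relation.Unary.All as All using (all?)
open import Data.List.Relation.Unary.AllPairs using (AllPairs)
open import Data.List.Relation.Unary.Any using (here; there)
open import Data.List.Relation.Unary.Unique.Propositional using (Unique)
open import Data.Nat.Base as ℕ using (ℕ; zero; suc)
import Data.Nat.Properties as ℕ
open import Data.Product.Base using (∃; _×_; _,_; proj₁; proj₂)
open import Data.Product.Properties using (≡-dec)
open import Data.Product.Relation.Binary.Pointwise.NonDependent
  using (Pointwise; ×-decidable)
open import Data.Sum.Base using (_⊎_; inj₁; inj₂)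
open import Function.Base using (_∘_; id)
import Function.Endo.Propositional as Endo
open import Relation.Binary.Core using (Rel)
open import Relation.Binary.Definitions using (Decidable; DecidableEquality)
open import Relation.Binary.PropositionalEquality.Core as ≡ using (_≡_; _≢_)
open import Relation.Binary.Structures using (IsStrictPartialOrder)
import Relation.Binary.Construct.NonStrictToStrict as NonStrictToStrict
open import Relation.Binary.Construct.Add.Extrema.Strict as Extrema
  using (<±-dec; ⊥±<[_]; ⊥±<⊤±; [_]<⊤±)
import Relation.Binary.Construct.Add.Infimum.Strict as Infimum
import Relation.Binary.Construct.Add.Supremum.Strict as Supremum
open import Relation.Nullary using (¬_; yes; no)
open import Relation.Nullary.Construct.Add.Extrema using (_±; ⊥±; ⊤±; [_])
open import Relation.Nullary.Decidable using (¬?; _×-dec_; map′)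

-- The real numbers, as a Cauchy complete Archimedean ordered field. The axioms
-- are the constructive ones (no decidability of order or equality), so both
-- the classical ℝ and the Cauchy reals satisfy them.

record Reals c ℓ₁ ℓ₂ : Set (lsuc (c ⊔ ℓ₁ ⊔ ℓ₂)) where
  infix  8 -_
  infixl 7 _*_
  infixl 6 _+_
  infix  4 _≈_ _<_ _≤_
  field
    Carrier : Set c
    _≈_     : Rel Carrier ℓ₁
    _<_     : Rel Carrier ℓ₂
    _+_ _*_ : Carrier → Carrier → Carrier
    -_      : Carrier → Carrier
    0# 1#   : Carrier

    isHeytingField       : IsHeytingField _≈_ (λ x y → x < y ⊎ y < x) _+_ _*_ -_ 0# 1#
    isStrictPartialOrder : IsStrictPartialOrder _≈_ _<_
    +-monoʳ-<            : ∀ x {y z} → y < z → x + y < x + z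
    *-positive           : ∀ {x y} → 0# < x → 0# < y → 0# < x * y

  open IsHeytingField isHeytingField public
    using (isCommutativeRing; #⇒invertible; invertible⇒#; tight; #-cotrans)
  open IsStrictPartialOrder isStrictPartialOrder public
    using (<-resp-≈; <-respʳ-≈; <-respˡ-≈)
    renaming (trans to <-trans; irrefl to <-irrefl; asym to <-asym)

  commutativeRing : CommutativeRing c ℓ₁
  commutativeRing = record { isCommutativeRing = isCommutativeRing }

  open CommutativeRing commutativeRing public
    hiding (Carrier; _≈_; _+_; _*_; -_; 0#; 1#; isCommutativeRing)

  open RawMonoidDefinitions +-rawMonoid public using () renaming (_×_ to _·_)
  open Summation +-commutativeMonoid public using (sum-syntax)

  _≤_ : Rel Carrier ℓ₂
  x ≤ y = ¬ (y < x)

  IsCauchy : (ℕ → Carrier) → Set (c ⊔ ℓ₂)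
  IsCauchy s = ∀ ε → 0# < ε → ∃ λ N → ∀ m n → N ℕ.≤ m → N ℕ.≤ n → s m < s n + ε

  _ConvergesTo_ : (ℕ → Carrier) → Carrier → Set (c ⊔ ℓ₂)
  s ConvergesTo l = ∀ ε → 0# < ε → ∃ λ N → ∀ n → N ℕ.≤ n → s n < l + ε × l < s n + ε

  field
    archimedean : ∀ x → ∃ λ n → x < n · 1#
    complete    : ∀ s → IsCauchy s → ∃ λ l → s ConvergesTo l

module PositiveReals {c ℓ₁ ℓ₂} (R : Reals c ℓ₁ ℓ₂) where

  open Reals R
  open RingProperties ring using (-‿distribˡ-*; -‿involutive; -0#≈0#)

  ℝ⁺ : Set (c ⊔ ℓ₂)
  ℝ⁺ = ∃ λ x → 0# < x

  private
    negate-pos : ∀ {x} → 0# < x → - x < 0#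
    negate-pos {x} p =
      <-respʳ-≈ (-‿inverseˡ x) (<-respˡ-≈ (+-identityʳ (- x)) (+-monoʳ-< (- x) p))

    negate-neg : ∀ {x} → x < 0# → 0# < - x
    negate-neg {x} p =
      <-respˡ-≈ (-‿inverseˡ x) (<-respʳ-≈ (+-identityʳ (- x)) (+-monoʳ-< (- x) p))

    x-0≈x : ∀ x → x - 0# ≈ x
    x-0≈x x = trans (+-congˡ -0#≈0#) (+-identityʳ x)

  +-positive : ∀ {x y} → 0# < x → 0# < y → 0# < x + y
  +-positive {x} p q = <-trans p (<-respˡ-≈ (+-identityʳ x) (+-monoʳ-< x q))

  private
    neg*neg : ∀ {x} → x < 0# → 0# < x * x
    neg*neg {x} p = <-respʳ-≈ eq (*-positive (negate-neg p) (negate-neg p))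
      where
      eq : - x * - x ≈ x * x
      eq = trans (sym (-‿distribˡ-* x (- x)))
          (trans (-‿cong (*-comm x (- x)))
          (trans (-‿cong (sym (-‿distribˡ-* x x))) (-‿involutive (x * x))))

  1-positive : 0# < 1#
  1-positive
    with invertible⇒# {1#} {0#}
           (1# , trans (*-identityˡ _) (x-0≈x 1#) , trans (*-identityʳ _) (x-0≈x 1#))
  ... | inj₁ 1<0 = <-respʳ-≈ (*-identityʳ 1#) (neg*neg 1<0)
  ... | inj₂ 0<1 = 0<1

  inverse : ∀ {x} → 0# < x → ∃ λ y → 0# < y × x * y ≈ 1#
  inverse {x} p with #⇒invertible (inj₂ p)
  ... | y , y*[x-0]≈1 , [x-0]*y≈1 = y , y-positive , x*y≈1
    where
    x*y≈1 : x * y ≈ 1#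
    x*y≈1 = trans (*-congʳ (sym (x-0≈x x))) [x-0]*y≈1

    y-0≈y = x-0≈x y

    y-positive : 0# < y
    y-positive
      with invertible⇒# {y} {0#}
             (x , trans (*-congˡ y-0≈y) x*y≈1
                , trans (*-congʳ y-0≈y) (trans (*-comm y x) x*y≈1))
    ... | inj₂ 0<y = 0<y
    ... | inj₁ y<0 = ⊥-elim (<-asym 1-positive (<-respˡ-≈ -x*-y≈1 (negate-pos q)))
      where
      q : 0# < x * - y
      q = *-positive p (negate-neg y<0)

      -x*-y≈1 : - (x * - y) ≈ 1#
      -x*-y≈1 = trans (-‿cong (*-comm x (- y)))
               (trans (-‿cong (sym (-‿distribˡ-* y x)))
               (trans (-‿involutive (y * x)) (trans (*-comm y x) x*y≈1)))

  infixl 7 _*⁺_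
  infixl 6 _+⁺_
  infix  8 _⁻¹

  1⁺ : ℝ⁺
  1⁺ = 1# , 1-positive

  _+⁺_ _*⁺_ : ℝ⁺ → ℝ⁺ → ℝ⁺
  (x , p) +⁺ (y , q) = x + y , +-positive p q
  (x , p) *⁺ (y , q) = x * y , *-positive p q

  _⁻¹ : ℝ⁺ → ℝ⁺
  (x , p) ⁻¹ = let y , q , _ = inverse p in y , q

  ∑⁺ : List⁺ ℝ⁺ → ℝ⁺
  ∑⁺ = foldr₁ _+⁺_

  ∥⁺ : List⁺ ℝ⁺ → ℝ⁺
  ∥⁺ ss = ∑⁺ (List⁺.map _⁻¹ ss) ⁻¹

  ∏⁺ : List ℝ⁺ → ℝ⁺
  ∏⁺ = foldr _*⁺_ 1⁺

  -- The natural logarithm is the only homomorphism from (ℝ⁺, ·) to (ℝ, +)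
  -- lying below its tangent at 1: the functional equation leaves only the
  -- choice of a base, which the inequality fixes to be e.

  record IsNaturalLog (log : ℝ⁺ → Carrier) : Set (c ⊔ ℓ₁ ⊔ ℓ₂) where
    field
      log-cong : ∀ {s t} → proj₁ s ≈ proj₁ t → log s ≈ log t
      log-*    : ∀ s t → log (s *⁺ t) ≈ log s + log t
      log≤x-1  : ∀ s → log s ≤ proj₁ s - 1#

-- The element (i , j) of Fin a × Fin b stands for (toℕ i + 1, toℕ j + 1) in [a] × [b].

module Rectangle (a b : ℕ) where

  P : Set
  P = Fin a × Fin b

  infix 4 _≤ᴾ_ _<ᴾ_ _<̂_ _⋖_ _≟ᴾ_ _<̂?_ _⋖?_

  _≤ᴾ_ _<ᴾ_ : Rel P lzero
  _≤ᴾ_ = Pointwise Fin._≤_ Fin._≤_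
  _<ᴾ_ = NonStrictToStrict._<_ _≡_ _≤ᴾ_

  _≟ᴾ_ : DecidableEquality P
  _≟ᴾ_ = ≡-dec Fin._≟_ Fin._≟_

  P̂ : Set
  P̂ = P ±

  _<̂_ : Rel P̂ lzero
  _<̂_ = Extrema._<±_ _<ᴾ_

  _⋖_ : Rel P̂ lzero
  y ⋖ x = y <̂ x × (∀ z → ¬ (y <̂ z × z <̂ x))

  elements : List P
  elements = cartesianProduct (allFin a) (allFin b)

  elementŝ : List P̂
  elementŝ = ⊥± ∷ ⊤± ∷ List.map [_] elements

  ∈-elements : ∀ x → x ∈ elements
  ∈-elements (i , j) = ∈-cartesianProduct⁺ (∈-allFin i) (∈-allFin j)

  ∈-elementŝ : ∀ x → x ∈ elementŝ
  ∈-elementŝ ⊥±    = here ≡.refl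
  ∈-elementŝ ⊤±    = there (here ≡.refl)
  ∈-elementŝ [ x ] = there (there (∈-map⁺ [_] (∈-elements x)))

  _<̂?_ : Decidable _<̂_
  _<̂?_ = <±-dec _<ᴾ_
    (NonStrictToStrict.<-decidable _≡_ _≤ᴾ_ _≟ᴾ_ (×-decidable Fin._≤?_ Fin._≤?_))

  _⋖?_ : Decidable _⋖_
  y ⋖? x = (y <̂? x) ×-dec
    map′ (λ none z → All.lookup none (∈-elementŝ z)) (λ none → All.tabulate (λ {z} _ → none z))
         (all? (λ z → ¬? ((y <̂? z) ×-dec (z <̂? x))) elementŝ)

  private
    shrink : ∀ {n} {i : Fin n} {k} → toℕ i ≡ suc k → ∃ λ (i′ : Fin n) → toℕ i′ ≡ k
    shrink {i = Fin.suc i} ≡.refl = Fin.inject₁ i , Fin.toℕ-inject₁ i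

    grow : ∀ {n} (i : Fin n) → (∃ λ (i′ : Fin n) → toℕ i′ ≡ suc (toℕ i)) ⊎ n ≡ suc (toℕ i)
    grow {n} i with suc (toℕ i) ℕ.<? n
    ... | yes i<n = inj₁ (Fin.fromℕ< i<n , Fin.toℕ-fromℕ< i<n)
    ... | no  i≮n = inj₂ (ℕ.≤-antisym (ℕ.≮⇒≥ i≮n) (Fin.toℕ<n i))

    squeeze : ∀ {n} {i i′ k : Fin n} → toℕ i′ ≡ suc (toℕ i) →
              i Fin.≤ k → k Fin.≤ i′ → k ≡ i ⊎ k ≡ i′
    squeeze {i = i} {k = k} eq i≤k k≤i′ with toℕ i ℕ.≟ toℕ k
    ... | yes i≡k = inj₁ (Fin.toℕ-injective (≡.sym i≡k))
    ... | no  i≢k = inj₂ (Fin.toℕ-injective (ℕ.≤-antisym k≤i′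
                      (≡.subst (ℕ._≤ toℕ k) (≡.sym eq) (ℕ.≤∧≢⇒< i≤k i≢k))))

    step≢ : ∀ {n} {i i′ : Fin n} → toℕ i′ ≡ suc (toℕ i) → i ≢ i′
    step≢ eq ≡.refl = ℕ.1+n≢n (≡.sym eq)

    step≤ : ∀ {n} {i i′ : Fin n} → toℕ i′ ≡ suc (toℕ i) → i Fin.≤ i′
    step≤ {i = i} eq = ≡.subst (toℕ i ℕ.≤_) (≡.sym eq) (ℕ.n≤1+n _)

    cover₁ : ∀ {i i′ : Fin a} {j : Fin b} → toℕ i′ ≡ suc (toℕ i) → [ i , j ] ⋖ [ i′ , j ]
    cover₁ {i} {i′} {j} eq =
      Extrema.[ (step≤ eq , ℕ.≤-refl) , (λ e → step≢ eq (≡.cong proj₁ e)) ] , none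
      where
      none : ∀ z → ¬ ([ i , j ] <̂ z × z <̂ [ i′ , j ])
      none [ k , l ] (Extrema.[ (i≤k , j≤l) , ≢₁ ] , Extrema.[ (k≤i′ , l≤j) , ≢₂ ])
        with Fin.toℕ-injective (ℕ.≤-antisym j≤l l≤j) | squeeze eq i≤k k≤i′
      ... | ≡.refl | inj₁ ≡.refl = ≢₁ ≡.refl
      ... | ≡.refl | inj₂ ≡.refl = ≢₂ ≡.refl

    cover₂ : ∀ {i : Fin a} {j j′ : Fin b} → toℕ j′ ≡ suc (toℕ j) → [ i , j ] ⋖ [ i , j′ ]
    cover₂ {i} {j} {j′} eq =
      Extrema.[ (ℕ.≤-refl , step≤ eq) , (λ e → step≢ eq (≡.cong proj₂ e)) ] , none
      where
      none : ∀ z → ¬ ([ i , j ] <̂ z × z <̂ [ i , j′ ])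
      none [ k , l ] (Extrema.[ (i≤k , j≤l) , ≢₁ ] , Extrema.[ (k≤i , l≤j′) , ≢₂ ])
        with Fin.toℕ-injective (ℕ.≤-antisym i≤k k≤i) | squeeze eq j≤l l≤j′
      ... | ≡.refl | inj₁ ≡.refl = ≢₁ ≡.refl
      ... | ≡.refl | inj₂ ≡.refl = ≢₂ ≡.refl

    cover-⊥ : ∀ {i j} → toℕ i ≡ 0 → toℕ j ≡ 0 → ⊥± ⋖ [ i , j ]
    cover-⊥ {i} {j} i≡0 j≡0 = ⊥±<[ _ ] , none
      where
      none : ∀ z → ¬ (⊥± <̂ z × z <̂ [ i , j ])
      none ⊥±        (Supremum.[ () ] , _)
      none ⊤±        (_ , ())
      none [ k , l ] (_ , Supremum.[ Infimum.[ (k≤i , l≤j) , ≢ ] ]) =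
        ≢ (≡.cong₂ _,_ (min k≤i i≡0) (min l≤j j≡0))
        where
        min : ∀ {n} {k i : Fin n} → k Fin.≤ i → toℕ i ≡ 0 → k ≡ i
        min {k = k} k≤i eq = Fin.toℕ-injective (≡.trans
          (ℕ.n≤0⇒n≡0 (≡.subst (toℕ k ℕ.≤_) eq k≤i)) (≡.sym eq))

    cover-⊤ : ∀ {i j} → a ≡ suc (toℕ i) → b ≡ suc (toℕ j) → [ i , j ] ⋖ ⊤±
    cover-⊤ {i} {j} a≡ b≡ = [ _ ]<⊤± , none
      where
      none : ∀ z → ¬ ([ i , j ] <̂ z × z <̂ ⊤±)
      none [ k , l ] (Extrema.[ (i≤k , j≤l) , ≢ ] , _) =
        ≢ (≡.cong₂ _,_ (max a≡ i≤k) (max b≡ j≤l))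
        where
        max : ∀ {n} {i k : Fin n} → n ≡ suc (toℕ i) → i Fin.≤ k → i ≡ k
        max {k = k} eq i≤k = Fin.toℕ-injective (ℕ.≤-antisym i≤k
          (ℕ.s≤s⁻¹ (≡.subst (toℕ k ℕ.<_) eq (Fin.toℕ<n k))))

  lowerCover : ∀ x → ∃ λ y → y ⋖ [ x ]
  lowerCover (i , j) with toℕ i in i≡ | toℕ j in j≡
  ... | zero  | zero  = ⊥± , cover-⊥ i≡ j≡
  ... | suc _ | _     = let i′ , eq = shrink i≡ in
                        [ i′ , j ] , cover₁ (≡.trans i≡ (≡.cong suc (≡.sym eq)))
  ... | zero  | suc _ = let j′ , eq = shrink j≡ in
                        [ i , j′ ] , cover₂ (≡.trans j≡ (≡.cong suc (≡.sym eq)))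

  upperCover : ∀ x → ∃ λ y → [ x ] ⋖ y
  upperCover (i , j) with grow i | grow j
  ... | inj₁ (i′ , eq) | _              = [ i′ , j ] , cover₁ eq
  ... | inj₂ _         | inj₁ (j′ , eq) = [ i , j′ ] , cover₂ eq
  ... | inj₂ a≡        | inj₂ b≡        = ⊤± , cover-⊤ a≡ b≡

  toList⁺ : ∀ {A : Set} {x : A} (xs : List A) → x ∈ xs → List⁺ A
  toList⁺ (x ∷ xs) _ = x ∷ xs

  infix 9 _⁻ _⁺

  _⁻ _⁺ : P → List⁺ P̂
  x ⁻ = toList⁺ (filter (_⋖? [ x ]) elementŝ)
          (∈-filter⁺ (_⋖? [ x ]) (∈-elementŝ _) (proj₂ (lowerCover x)))
  x ⁺ = toList⁺ (filter ([ x ] ⋖?_) elementŝ)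
          (∈-filter⁺ ([ x ] ⋖?_) (∈-elementŝ _) (proj₂ (upperCover x)))

  record IsLinearExtension (xs : List P) : Set where
    field
      unique  : Unique xs
      covers  : ∀ x → x ∈ xs
      ordered : AllPairs (λ x y → ¬ (y <ᴾ x)) xs

  -- j - i + a = k, with i moved to the right-hand side to stay in ℕ.
  InFile : ℕ → P → Set
  InFile k (i , j) = suc (toℕ j) ℕ.+ a ≡ k ℕ.+ suc (toℕ i)

  file : ℕ → List P
  file k = filter (λ (i , j) → suc (toℕ j) ℕ.+ a ℕ.≟ k ℕ.+ suc (toℕ i)) elements

module Birational {c ℓ₁ ℓ₂} (R : Reals c ℓ₁ ℓ₂) (a b : ℕ) where

  open Reals R
  open PositiveReals R public
  open Rectangle a b public

  n : ℕ
  n = a ℕ.+ b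

  Labeling : Set (c ⊔ ℓ₂)
  Labeling = P → ℝ⁺

  open Endo Labeling public using (Endo; _^_)

  extend : Labeling → P̂ → ℝ⁺
  extend f ⊥±    = 1⁺
  extend f ⊤±    = 1⁺
  extend f [ x ] = f x

  τ : P → Endo
  τ x f y with y ≟ᴾ x
  ... | no  _ = f y
  ... | yes _ = f x ⁻¹ *⁺ ∑⁺ (List⁺.map (extend f) (x ⁻)) *⁺ ∥⁺ (List⁺.map (extend f) (x ⁺))

  -- compose (g₁ ∷ … ∷ gₘ ∷ []) = g₁ ∘ … ∘ gₘ
  compose : List Endo → Endo
  compose = foldr (λ g h → g ∘ h) id

  rowmotion : List P → Endo
  rowmotion xs = compose (List.map τ xs)

  -- Distinct elements of a file never cover one another, so their toggles
  -- commute and the order in which file k lists them is immaterial.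
  τ* : ℕ → Endo
  τ* k = compose (List.map τ (file k))

  -- downFrom (n ∸ 1) is n-2, …, 1, 0.
  promotion : Endo
  promotion = compose (List.map (τ* ∘ suc) (downFrom (n ℕ.∸ 1)))

  module Functionals (log : ℝ⁺ → Carrier) where

    -- opposite i stands for a + 1 - i, and opposite j for b + 1 - j.
    F-antipodal : Fin a → Fin b → Labeling → Carrier
    F-antipodal i j f = log (f (i , j) *⁺ f (opposite i , opposite j))

    F-file : ℕ → Labeling → Carrier
    F-file k f = log (∏⁺ (List.map f (file k)))

  ZeroMesic : Endo → (Labeling → Carrier) → Set (c ⊔ ℓ₁ ⊔ ℓ₂)
  ZeroMesic T F = ∀ f → ∑[ m < n ] F ((T ^ toℕ m) f) ≈ 0#

{-# OPTIONS --safe #-}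

-- Let f_t be an orbit of rowmotion; for promotion, delaying the j-th column by b - j steps gives a
-- solution of the same recurrence. The recurrence says that
--   D_t (v) = (sum of f_t over v⁻) / f_t (v) = f_{t+1} (v) · (sum of 1 / f_{t+1} over v⁺).
-- Let Φ_t be the product over the rows of the bidiagonal matrices D_t - σ, where σ shifts the
-- columns by one. An exchange relation between factors gives Φ_{t+1} σ = σ Φ_t, while Φ_t maps the
-- last row of f_t to a unit vector and the first row of 1 / f_{t+1} (from the left) to another.
-- This yields f_t (a + 1 - i , b + 1 - j) f_{t+i+j-1} (i , j) = 1 for i = 1, and the recurrence
-- propagates it to all i. Hence the period is n and antipodal products average out.
-- For the files, let F_k be the sum of log f over file k and over a period. Pairing the sum over v⁻
-- with the parallel sum over the next lower element of the same file turns the recurrence into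
-- 2 F_k = F_{k-1} + F_{k+1}; as F_0 = F_n = 0, every F_k vanishes.
module Submission where

open import Defs
open import Algebra.Bundles using (CommutativeRing)
import Algebra.Properties.CommutativeMonoid.Sum as Summation
import Algebra.Properties.Ring as RingProperties
import Algebra.Properties.Semiring.Sum as SemiringSummation
import Algebra.Solver.Ring.NaturalCoefficients.Default as SemiringSolver
open import Data.Fin.Base as Fin using (Fin; toℕ; fromℕ<; opposite)
import Data.Fin.Properties as Fin
open import Data.List.Base as List
  using (List; []; _∷_; _++_; filter; concatMap; downFrom; cartesianProduct; tabulate)
open import Data.List.Membership.Propositional using (_∈_; _∉_)
open import Data.List.Membership.Propositional.Properties
  using (∈-filter⁺; ∈-filter⁻; ∈-++⁺ˡ; ∈-++⁺ʳ)
open import Data.List.Membership.Propositional.Properties.WithK using (unique∧set⇒bag)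
open import Data.List.NonEmpty as List⁺ using (List⁺; _∷_)
import Data.List.Properties as List
open import Data.List.Relation.Binary.BagAndSetEquality using (∼bag⇒↭)
open import Data.List.Relation.Binary.Permutation.Propositional as Perm using (_↭_)
open import Data.List.Relation.Unary.All as All using (All; []; _∷_)
import Data.List.Relation.Unary.All.Properties as All
open import Data.List.Relation.Unary.AllPairs as AllPairs using (AllPairs; []; _∷_)
import Data.List.Relation.Unary.AllPairs.Properties as AllPairs
open import Data.List.Relation.Unary.Any using (here; there)
open import Data.List.Relation.Unary.Unique.Propositional using (Unique)
import Data.List.Relation.Unary.Unique.Propositional.Properties as Unique
open import Data.Nat.Base as ℕ using (ℕ; zero; suc; _∸_; _<_; _≤_; z≤n; s≤s; z<s; s<s; s≤s⁻¹)
import Data.Nat.Properties as ℕ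
open import Data.Nat.Tactic.RingSolver using () renaming (solve-∀ to solve-∀-ℕ)
open import Data.Product.Base using (∃; _×_; _,_; proj₁; proj₂)
open import Data.Sum.Base using (_⊎_; inj₁; inj₂)
open import Function.Base using (_∘_; id)
open import Function.Bundles using (mk⇔)
open import Level as Level using (_⊔_)
open import Relation.Binary.Construct.Add.Extrema.Strict as Extrema using (⊥±<[_]; [_]<⊤±)
import Relation.Binary.Construct.Add.Infimum.Strict as Infimum
import Relation.Binary.Construct.Add.Supremum.Strict as Supremum
open import Relation.Binary.Core using (Rel)
open import Relation.Binary.PropositionalEquality.Core as ≡ using (_≡_; _≢_)
import Relation.Binary.Reasoning.Setoid as SetoidReasoning
open import Relation.Nullary using (¬_; yes; no; contradiction)
open import Relation.Nullary.Construct.Add.Extrema using (⊥±; ⊤±; [_]; [_]-injective)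
open import Relation.Unary using (Pred; Decidable)

-- The array part works in any commutative ring, with `x` and its inverse `y` given side by side:
-- zeros stand for missing neighbours in both, so a total inverse is out of the question. The two
-- expressions for D_t have different uses. By the first, D_t - σ sends each row of f_t to the row
-- before it; by the second, its transpose sends each row of 1 / f_{t+1} to the row after it. The
-- unit vectors at the two ends are the values at 0̂ and 1̂, and powers of σ bring each entry of the
-- last row to the column of 1̂. For promotion the delayed array mixes labelings of different times,
-- both inside a file and inside an antipodal pair. Only the sum of a single entry over a whole
-- period is blind to the delay, so the results are transferred entry by entry. This presupposes
-- that promotion itself is periodic, which the array yields only after the initial times that it
-- does not show in full; injectivity of promotion closes that gap.

module RowmotionArrays {c ℓ} (R : CommutativeRing c ℓ) where

  open CommutativeRing R
  open Summation +-commutativeMonoid using (sum; sum-syntax; sum-cong-≋; sum-replicate-zero)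
  open RingProperties ring using (+-cancelʳ; -0#≈0#; -‿distribʳ-*; -‿+-comm)
  open SemiringSolver commutativeSemiring using (solve; con; _:=_; _:+_; _:*_)
  open SetoidReasoning setoid

  -- Bidiagonal operators on vectors

  δ : ℕ → ℕ → Carrier
  δ zero    zero    = 1#
  δ zero    (suc _) = 0#
  δ (suc _) zero    = 0#
  δ (suc i) (suc j) = δ i j

  δ-refl : ∀ i → δ i i ≈ 1#
  δ-refl zero    = refl
  δ-refl (suc i) = δ-refl i

  δ-< : ∀ {i j} → j < i → δ i j ≈ 0#
  δ-< {suc i} {zero}  _       = refl
  δ-< {suc i} {suc j} (s≤s p) = δ-< p

  ∑-δ : ∀ {n k} (g : ℕ → Carrier) → k < n → ∑[ c < n ] (g (toℕ c) * δ k (toℕ c)) ≈ g k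
  ∑-δ {suc n} {zero} g _ = begin
    g 0 * 1# + ∑[ c < n ] (g (suc (toℕ c)) * 0#)
      ≈⟨ +-cong (*-identityʳ _) (trans (sum-cong-≋ {n} λ c → zeroʳ _) (sum-replicate-zero n)) ⟩
    g 0 + 0#  ≈⟨ +-identityʳ _ ⟩
    g 0       ∎
  ∑-δ {suc n} {suc k} g (s≤s k<n) = begin
    g 0 * 0# + ∑[ c < n ] (g (suc (toℕ c)) * δ k (toℕ c))
      ≈⟨ +-cong (zeroʳ _) (∑-δ (λ c → g (suc c)) k<n) ⟩
    0# + g (suc k)  ≈⟨ +-identityˡ _ ⟩
    g (suc k)       ∎

  inverse-unique : ∀ {u v w} → u * v ≈ 1# → u * w ≈ 1# → v ≈ w
  inverse-unique {u} {v} {w} uv uw = begin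
    v            ≈⟨ *-identityʳ v ⟨
    v * 1#       ≈⟨ *-congˡ uw ⟨
    v * (u * w)  ≈⟨ shuffle u v w ⟩
    u * v * w    ≈⟨ *-congʳ uv ⟩
    1# * w       ≈⟨ *-identityˡ w ⟩
    w            ∎
    where
    shuffle : ∀ u v w → v * (u * w) ≈ u * v * w
    shuffle = solve 3 (λ u v w → v :* (u :* w) := u :* v :* w) refl

  Vector : Set c
  Vector = ℕ → Carrier

  -- A vector stands for a function on the columns 1, 2, …; its entry at 0 is meant to be 0.
  σ : Vector → Vector
  σ w zero    = 0#
  σ w (suc c) = w c

  L : (ℕ → Carrier) → Vector → Vector
  L D w zero    = 0#
  L D w (suc c) = D c * w (suc c) - w c

  -- Φ D r = L (D 0) ∘ … ∘ L (D (r - 1)) is a product of the bidiagonal operators L (D i) = D i - σ.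
  Φ : (ℕ → ℕ → Carrier) → ℕ → Vector → Vector
  Φ D zero    w = w
  Φ D (suc r) w = Φ D r (L (D r) w)

  infix 4 _≈[<_]_
  _≈[<_]_ : Vector → ℕ → Vector → Set ℓ
  u ≈[< b ] v = ∀ {c} → c < b → u c ≈ v c

  L-cong : ∀ {b D E u v} → (∀ {c} → suc c < b → D c ≈ E c) → u ≈[< b ] v → L D u ≈[< b ] L E v
  L-cong D≈E u≈v {zero}  _ = refl
  L-cong D≈E u≈v {suc c} p =
    +-cong (*-cong (D≈E p) (u≈v p)) (-‿cong (u≈v (ℕ.<-trans (ℕ.n<1+n c) p)))

  Φ-cong : ∀ {b u v} D r → u ≈[< b ] v → Φ D r u ≈[< b ] Φ D r v
  Φ-cong D zero    u≈v = u≈v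
  Φ-cong D (suc r) u≈v = Φ-cong D r (L-cong (λ _ → refl) u≈v)

  σ-cong : ∀ {b u v} → u ≈[< b ] v → σ u ≈[< suc b ] σ v
  σ-cong u≈v {zero}  _       = refl
  σ-cong u≈v {suc c} (s≤s p) = u≈v p

  -- Passing a diagonal matrix through the shift moves its entries by one column. Column 1 would
  -- keep the product `D 0 * w 0`, which the hypothesis removes.
  σL : ∀ D {w} → w 0 ≈ 0# → ∀ c → L D (σ w) c ≈ σ (L (λ c → D (suc c)) w) c
  σL D     w₀ zero          = refl
  σL D {w} w₀ (suc zero)    = begin
    D 0 * w 0 - 0#  ≈⟨ +-cong (trans (*-congˡ w₀) (zeroʳ _)) -0#≈0# ⟩
    0# + 0#         ≈⟨ +-identityʳ 0# ⟩
    0#              ∎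
  σL D     w₀ (suc (suc c)) = refl

  σΦ : ∀ D r {w b} → w 0 ≈ 0# → Φ D r (σ w) ≈[< b ] σ (Φ (λ r c → D r (suc c)) r w)
  σΦ D zero        w₀ _ = refl
  σΦ D (suc r) {w} w₀ p =
    trans (Φ-cong D r (λ {c} _ → σL (D r) w₀ c) p) (σΦ D r refl p)

  neg-distrib : ∀ u v w → - (u * v + w) ≈ u * - v - w
  neg-distrib u v w = trans (sym (-‿+-comm (u * v) w)) (+-congʳ (-‿distribʳ-* u v))

  -- The hypothesis says that the transpose of `L D` sends `g` to `h`; the two boundary terms are
  -- what the telescoping of `g c * w c` leaves over.
  summation-by-parts : ∀ {n} {g h : ℕ → Carrier} D w →
    (∀ {c} → c < n → g c * D c ≈ h c + g (suc c)) →
    ∑[ c < n ] (g (toℕ c) * L D w (suc (toℕ c))) + g 0 * w 0 ≈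
    ∑[ c < n ] (h (toℕ c) * w (suc (toℕ c))) + g n * w n
  summation-by-parts {zero} D w eq = refl
  summation-by-parts {suc n} {g} {h} D w eq = begin
    g 0 * (D 0 * w 1 - w 0) + s + g 0 * w 0      ≈⟨ move (g 0) (D 0) (w 1) (w 0) (- w 0) s ⟩
    g 0 * D 0 * w 1 + s + g 0 * (- w 0 + w 0)    ≈⟨ +-cong (+-congʳ (*-congʳ (eq z<s)))
                                                     (trans (*-congˡ (-‿inverseˡ (w 0))) (zeroʳ (g 0))) ⟩
    (h 0 + g 1) * w 1 + s + 0#                   ≈⟨ collect (h 0) (g 1) (w 1) s ⟩
    h 0 * w 1 + (s + g 1 * w 1)                  ≈⟨ +-congˡ ih ⟩
    h 0 * w 1 + (s′ + g (suc n) * w (suc n))     ≈⟨ +-assoc _ _ _ ⟨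
    h 0 * w 1 + s′ + g (suc n) * w (suc n)       ∎
    where
    s s′ : Carrier
    s  = ∑[ c < n ] (g (suc (toℕ c)) * L D w (suc (suc (toℕ c))))
    s′ = ∑[ c < n ] (h (suc (toℕ c)) * w (suc (suc (toℕ c))))
    ih : s + g 1 * w 1 ≈ s′ + g (suc n) * w (suc n)
    ih = summation-by-parts (λ c → D (suc c)) (λ c → w (suc c)) (λ p → eq (s<s p))
    move : ∀ g d w₁ w₀ m s → g * (d * w₁ + m) + s + g * w₀ ≈ g * d * w₁ + s + g * (m + w₀)
    move = solve 6 (λ g d w₁ w₀ m s → g :* (d :* w₁ :+ m) :+ s :+ g :* w₀ := g :* d :* w₁ :+ s :+ g :* (m :+ w₀)) refl
    collect : ∀ h g w s → (h + g) * w + s + 0# ≈ h * w + (s + g * w)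
    collect = solve 4 (λ h g w s → (h :+ g) :* w :+ s :+ con 0 := h :* w :+ (s :+ g :* w)) refl

  -- Reciprocity and periodicity of rowmotion arrays

  +⇒<ʳ : ∀ {m k n} → m ℕ.+ suc k ≡ n → k < n
  +⇒<ʳ {m} ≡.refl = ℕ.m≤n+m _ m

  +⇒<ˡ : ∀ {m k n} → m ℕ.+ suc k ≡ n → m < n
  +⇒<ˡ {m} {k} ≡.refl = ℕ.≤-trans (s≤s (ℕ.m≤m+n m k)) (ℕ.≤-reflexive (≡.sym (ℕ.+-suc m k)))

  -- Rows and columns are numbered from 1, the first argument is time, and y is 1 / x. The values at 0̂
  -- and 1̂ sit at (0 , 1) and (a + 1 , b); otherwise x vanishes on row and column 0, and y on row
  -- a + 1 and column b + 1, so that missing neighbours contribute nothing to either sum.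
  record RowmotionArray (a b : ℕ) : Set (c ⊔ ℓ) where
    field
      x y : ℕ → ℕ → ℕ → Carrier
      x*y≈1 : ∀ t {i j} → i < a → j < b → x t (suc i) (suc j) * y t (suc i) (suc j) ≈ 1#
      x-column₀ : ∀ t i → x t i 0 ≈ 0#
      x-row₀    : ∀ t j → x t 0 (suc j) ≈ δ 0 j
      y-column  : ∀ t {i} → i < a → y t (suc i) (suc b) ≈ 0#
      y-row     : ∀ t {j} → j < b → y t (suc a) (suc j) ≈ δ b (suc j)
      evolve    : ∀ t {i j} → i < a → j < b →
        (x t i (suc j) + x t (suc i) j) * y t (suc i) (suc j) ≈
        x (suc t) (suc i) (suc j) * (y (suc t) (suc (suc i)) (suc j) + y (suc t) (suc i) (suc (suc j)))

    D : ℕ → ℕ → ℕ → Carrier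
    D t r c = (x t r (suc c) + x t (suc r) c) * y t (suc r) (suc c)

    -- The diagonal entry times `x` restores the sum of both lower neighbours, and the shift
    -- subtracts the one in the same row.
    L-x : ∀ t {r} → r < a → L (D t r) (x t (suc r)) ≈[< suc b ] x t r
    L-x t {r} r<a {zero}  _           = sym (x-column₀ t r)
    L-x t {r} r<a {suc c} (s≤s c<b) = begin
      (u + v) * yₜ * xₜ - v  ≈⟨ +-congʳ (swap (u + v) yₜ xₜ) ⟩
      (u + v) * (xₜ * yₜ) - v ≈⟨ +-congʳ (trans (*-congˡ (x*y≈1 t r<a c<b)) (*-identityʳ _)) ⟩
      u + v - v              ≈⟨ trans (+-assoc u v (- v)) (trans (+-congˡ (-‿inverseʳ v)) (+-identityʳ u)) ⟩
      u                      ∎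
      where
      u v xₜ yₜ : Carrier
      u  = x t r (suc c)
      v  = x t (suc r) c
      xₜ = x t (suc r) (suc c)
      yₜ = y t (suc r) (suc c)
      swap : ∀ u v w → u * v * w ≈ u * (w * v)
      swap = solve 3 (λ u v w → u :* v :* w := u :* (w :* v)) refl

    Φ-x : ∀ t {r} → r ≤ a → Φ (D t) r (x t r) ≈[< suc b ] x t 0
    Φ-x t {zero}  _   p = refl
    Φ-x t {suc r} r<a p =
      trans (Φ-cong (D t) r (L-x t r<a) p) (Φ-x t (ℕ.<⇒≤ r<a) p)

    -- The columns are shifted by one: column c + 2 of time t + 1 is compared with column c + 1 of
    -- time t. With Y r = L (q r), the factors of Φ are Y r + e r at time t + 1 and Y r + eˢ r at
    -- time t, and since Y r ∘ e (r + 1) = eˢ r ∘ Y (r + 1), moving the Y through the product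
    -- turns one into the other; e 0 and eˢ (a - 1) vanish.
    module Shift (t : ℕ) where

      q e eˢ : ℕ → ℕ → Carrier
      q  r c = x (suc t) (suc r) (suc c) * y (suc t) (suc r) (suc (suc c))
      e  r c = x (suc t) r (suc (suc c)) * y (suc t) (suc r) (suc (suc c))
      eˢ r c = x (suc t) (suc r) (suc c) * y (suc t) (suc (suc r)) (suc c)

      D′ : ℕ → ℕ → Carrier
      D′ r c = D (suc t) r (suc c)

      D′≈ : ∀ r c → D′ r c ≈ q r c + e r c
      D′≈ r c = trans (distribʳ _ _ _) (+-comm _ _)

      D≈ : ∀ {r c} → r < a → c < b → D t r c ≈ eˢ r c + q r c
      D≈ r<a c<b = trans (evolve t r<a c<b) (distribˡ _ _ _)

      -- The two sides run around a unit square from corner `u` to the opposite corner `v` by its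
      -- two paths; on either path the factors at the intermediate corner multiply to 1.
      q*e : ∀ {r c} → suc r < a → suc c < b → q r c * e (suc r) c ≈ eˢ r c * q (suc r) c
      q*e {r} {c} r<a c<b = begin
        u * y₁ * (x₁ * v)  ≈⟨ left u y₁ x₁ v ⟩
        u * (x₁ * y₁) * v  ≈⟨ *-congʳ (*-congˡ (trans (x*y≈1 (suc t) (ℕ.<-trans (ℕ.n<1+n r) r<a) c<b)
                                (sym (x*y≈1 (suc t) r<a (ℕ.<-trans (ℕ.n<1+n c) c<b))))) ⟩
        u * (x₂ * y₂) * v  ≈⟨ right u y₂ x₂ v ⟩
        u * y₂ * (x₂ * v)  ∎
        where
        u v x₁ x₂ y₁ y₂ : Carrier
        u  = x (suc t) (suc r) (suc c)
        v  = y (suc t) (suc (suc r)) (suc (suc c))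
        x₁ = x (suc t) (suc r) (suc (suc c))
        y₁ = y (suc t) (suc r) (suc (suc c))
        x₂ = x (suc t) (suc (suc r)) (suc c)
        y₂ = y (suc t) (suc (suc r)) (suc c)
        left : ∀ u y x v → u * y * (x * v) ≈ u * (x * y) * v
        left = solve 4 (λ u y x v → u :* y :* (x :* v) := u :* (x :* y) :* v) refl
        right : ∀ u y x v → u * (x * y) * v ≈ u * y * (x * v)
        right = solve 4 (λ u y x v → u :* (x :* y) :* v := u :* y :* (x :* v)) refl

      exchange : ∀ {r w} → w 0 ≈ 0# → suc r < a →
        L (q r) (L (D′ (suc r)) w) ≈[< b ] L (D t r) (L (q (suc r)) w)
      exchange w₀ r<a {zero} p = refl
      exchange {r} {w} w₀ r<a {suc c} p = begin
        q r c * (D′ (suc r) c * w (suc c) - w c) - L (D′ (suc r)) w c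
          ≈⟨ +-cong (*-congˡ (+-congʳ (*-congʳ (D′≈ (suc r) c)))) (trans (-‿cong (prev c)) (neg-distrib _ _ _)) ⟩
        q r c * ((q (suc r) c + e (suc r) c) * w (suc c) - w c) + (eˢ r c * - w c - L (q (suc r)) w c)
          ≈⟨ expand (q r c) (q (suc r) c) (e (suc r) c) (w (suc c)) (- w c) (eˢ r c) (- L (q (suc r)) w c) ⟩
        (q r c * e (suc r) c + q r c * q (suc r) c) * w (suc c) + (eˢ r c + q r c) * - w c - L (q (suc r)) w c
          ≈⟨ +-congʳ (+-congʳ (*-congʳ (+-congʳ (q*e r<a p)))) ⟩
        (eˢ r c * q (suc r) c + q r c * q (suc r) c) * w (suc c) + (eˢ r c + q r c) * - w c - L (q (suc r)) w c
          ≈⟨ factor (q r c) (q (suc r) c) (w (suc c)) (- w c) (eˢ r c) (- L (q (suc r)) w c) ⟩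
        (eˢ r c + q r c) * (q (suc r) c * w (suc c) - w c) - L (q (suc r)) w c
          ≈⟨ +-congʳ (*-congʳ (D≈ (ℕ.<-trans (ℕ.n<1+n r) r<a) (ℕ.<-trans (ℕ.n<1+n c) p))) ⟨
        D t r c * (q (suc r) c * w (suc c) - w c) - L (q (suc r)) w c  ∎
        where
        -- By definition `eˢ r (suc c)` is `e (suc r) c`, so carrying `e` through the shift needs no
        -- relation between values; `q*e` is used for the diagonal part alone.
        prev : ∀ c → L (D′ (suc r)) w c ≈ eˢ r c * w c + L (q (suc r)) w c
        prev zero    = sym (trans (+-identityʳ _) (trans (*-congˡ w₀) (zeroʳ _)))
        prev (suc c) = trans (+-congʳ (*-congʳ (D′≈ (suc r) c)))
                             (lemma (q (suc r) c) (e (suc r) c) (w (suc c)) (- w c))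
          where
          lemma : ∀ q e w v → (q + e) * w + v ≈ e * w + (q * w + v)
          lemma = solve 4 (λ q e w v → (q :+ e) :* w :+ v := e :* w :+ (q :* w :+ v)) refl
        expand : ∀ q q′ e w m s l → q * ((q′ + e) * w + m) + (s * m + l) ≈ (q * e + q * q′) * w + (s + q) * m + l
        expand = solve 7 (λ q q′ e w m s l → q :* ((q′ :+ e) :* w :+ m) :+ (s :* m :+ l) := (q :* e :+ q :* q′) :* w :+ (s :+ q) :* m :+ l) refl
        factor : ∀ q q′ w m s l → (s * q′ + q * q′) * w + (s + q) * m + l ≈ (s + q) * (q′ * w + m) + l
        factor = solve 6 (λ q q′ w m s l → (s :* q′ :+ q :* q′) :* w :+ (s :+ q) :* m :+ l := (s :+ q) :* (q′ :* w :+ m) :+ l) refl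

      telescope : ∀ {r w} → w 0 ≈ 0# → r < a →
        Φ D′ (suc r) w ≈[< b ] Φ (D t) r (L (q r) w)
      telescope {zero} {w} w₀ r<a = L-cong first (λ _ → refl)
        where
        -- Because of the shifted columns, `e 0` reads row 0 only from column 2 on, past the value
        -- at 0̂.
        first : ∀ {c} → suc c < b → D′ 0 c ≈ q 0 c
        first {c} p = begin
          D′ 0 c         ≈⟨ D′≈ 0 c ⟩
          q 0 c + e 0 c  ≈⟨ +-congˡ (trans (*-congʳ (x-row₀ (suc t) (suc c))) (zeroˡ _)) ⟩
          q 0 c + 0#     ≈⟨ +-identityʳ _ ⟩
          q 0 c          ∎
      telescope {suc r} {w} w₀ r<a p =
        trans (telescope {r} refl (ℕ.<-trans (ℕ.n<1+n r) r<a) p)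
              (Φ-cong (D t) r (exchange w₀ r<a) p)

      Φ-shifted : ∀ {w} → 0 < a → w 0 ≈ 0# → Φ D′ a w ≈[< b ] Φ (D t) a w
      Φ-shifted {w} 0<a w₀ p = go a ≡.refl 0<a
        where
        go : ∀ a′ → a′ ≡ a → 0 < a′ → Φ D′ a′ w _ ≈ Φ (D t) a′ w _
        go (suc r) ≡.refl _ = trans (telescope w₀ ℕ.≤-refl p)
          (Φ-cong (D t) r (L-cong {D = q r} {E = D t r} last (λ _ → refl)) p)
          where
          -- Row `suc a` of `y` is 1 at column `b`, the place of 1̂. `L-cong` asks only for
          -- `suc c < b`, which keeps clear of it.
          last : ∀ {c} → suc c < b → q r c ≈ D t r c
          last {c} sc<b = sym (begin
            D t r c         ≈⟨ D≈ ℕ.≤-refl c<b ⟩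
            eˢ r c + q r c  ≈⟨ +-congʳ (trans (*-congˡ (trans (y-row (suc t) c<b) (δ-< sc<b))) (zeroʳ _)) ⟩
            0# + q r c      ≈⟨ +-identityˡ _ ⟩
            q r c           ∎)
            where c<b = ℕ.<-trans (ℕ.n<1+n c) sc<b

    Φ-σ : ∀ t {w} → 0 < a → w 0 ≈ 0# → Φ (D (suc t)) a (σ w) ≈[< suc b ] σ (Φ (D t) a w)
    Φ-σ t 0<a w₀ p = trans (σΦ (D (suc t)) a w₀ p) (σ-cong (Shift.Φ-shifted t 0<a w₀) p)

    σ^ : ℕ → Vector → Vector
    σ^ zero    w = w
    σ^ (suc k) w = σ (σ^ k w)

    σ^-0 : ∀ k {w} → w 0 ≈ 0# → σ^ k w 0 ≈ 0#
    σ^-0 zero    w₀ = w₀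
    σ^-0 (suc k) w₀ = refl

    σ^-+ : ∀ k w c → σ^ k w (k ℕ.+ c) ≡ w c
    σ^-+ zero    w c = ≡.refl
    σ^-+ (suc k) w c = σ^-+ k w c

    σ^-x₀ : ∀ k t c → σ^ k (x t 0) (suc c) ≈ δ k c
    σ^-x₀ zero    t c       = x-row₀ t c
    σ^-x₀ (suc k) t zero    = σ^-0 k (x-column₀ t 0)
    σ^-x₀ (suc k) t (suc c) = σ^-x₀ k t c

    -- Each use of `Φ-σ` trades one shift for one step of time. The outcome is the unit vector at
    -- column `suc k`.
    Φ-σ^ : ∀ t k → 0 < a → Φ (D (k ℕ.+ t)) a (σ^ k (x t a)) ≈[< suc b ] σ^ k (x t 0)
    Φ-σ^ t zero    0<a p = Φ-x t ℕ.≤-refl p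
    Φ-σ^ t (suc k) 0<a p = trans (Φ-σ (k ℕ.+ t) 0<a (σ^-0 k (x-column₀ t a)) p)
      (σ-cong (λ q → Φ-σ^ t k 0<a (ℕ.<-trans q (ℕ.n<1+n b))) p)

    -- The transposed counterpart of `L-x`: by `evolve`, row `suc r` of `y` times the diagonal entry
    -- is the sum over both upper neighbours, and the transposed shift takes away the one in the
    -- same row.
    pairing-step : ∀ t {r w} → r < a → w 0 ≈ 0# →
      ∑[ c < b ] (y (suc t) (suc r) (suc (toℕ c)) * L (D t r) w (suc (toℕ c))) ≈
      ∑[ c < b ] (y (suc t) (suc (suc r)) (suc (toℕ c)) * w (suc (toℕ c)))
    pairing-step t {r} {w} r<a w₀ = begin
      s                           ≈⟨ +-identityʳ s ⟨
      s + 0#                      ≈⟨ +-congˡ (trans (*-congˡ w₀) (zeroʳ _)) ⟨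
      s + y (suc t) (suc r) 1 * w 0
        ≈⟨ summation-by-parts {b} {λ c → y (suc t) (suc r) (suc c)} {λ c → y (suc t) (suc (suc r)) (suc c)}
             (D t r) w g*D ⟩
      s′ + y (suc t) (suc r) (suc b) * w b
                                  ≈⟨ +-congˡ (trans (*-congʳ (y-column (suc t) r<a)) (zeroˡ _)) ⟩
      s′ + 0#                     ≈⟨ +-identityʳ s′ ⟩
      s′                          ∎
      where
      s s′ : Carrier
      s  = ∑[ c < b ] (y (suc t) (suc r) (suc (toℕ c)) * L (D t r) w (suc (toℕ c)))
      s′ = ∑[ c < b ] (y (suc t) (suc (suc r)) (suc (toℕ c)) * w (suc (toℕ c)))
      swap : ∀ u v w → u * (v * w) ≈ v * u * w
      swap = solve 3 (λ u v w → u :* (v :* w) := v :* u :* w) refl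
      g*D : ∀ {c} → c < b → y (suc t) (suc r) (suc c) * D t r c ≈
            y (suc t) (suc (suc r)) (suc c) + y (suc t) (suc r) (suc (suc c))
      g*D {c} c<b = trans (*-congˡ (evolve t r<a c<b)) (trans (swap _ _ _)
        (trans (*-congʳ (x*y≈1 (suc t) r<a c<b)) (*-identityˡ _)))

    pairing : ∀ t {r w} → r ≤ a → w 0 ≈ 0# →
      ∑[ c < b ] (y (suc t) 1 (suc (toℕ c)) * Φ (D t) r w (suc (toℕ c))) ≈
      ∑[ c < b ] (y (suc t) (suc r) (suc (toℕ c)) * w (suc (toℕ c)))
    pairing t {zero}  r≤a w₀ = refl
    pairing t {suc r} {w} r<a w₀ =
      trans (pairing t {r} (ℕ.<⇒≤ r<a) refl) (pairing-step t {w = w} r<a w₀)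

    -- One pairing is evaluated twice, that of row 1 of `y` with the image under `Φ` of the last row
    -- of `x` shifted `k` times. Applied to the left, `Φ` yields the unit vector at column `b`,
    -- where the shifts have put column `suc j`; applied to the right, it yields the unit vector at
    -- column `suc k`.
    reciprocity-row₁ : ∀ t k {j} → 0 < a → k ℕ.+ suc j ≡ b → x t a (suc j) ≈ y (suc (k ℕ.+ t)) 1 (suc k)
    reciprocity-row₁ t k {j} 0<a k+j≡b = begin
      x t a (suc j)                                      ≡⟨ σ^-+ k (x t a) (suc j) ⟨
      w (k ℕ.+ suc j)                                    ≡⟨ ≡.cong w (ℕ.+-suc k j) ⟩
      w (suc (k ℕ.+ j))                                  ≈⟨ ∑-δ {b} {k ℕ.+ j} (λ c → w (suc c)) k+j<b ⟨
      ∑[ c < b ] (w (suc (toℕ c)) * δ (k ℕ.+ j) (toℕ c)) ≈⟨ sum-cong-≋ {b} (λ c → trans (*-congʳ (top c)) (*-comm _ _)) ⟨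
      ∑[ c < b ] (y (suc (k ℕ.+ t)) (suc a) (suc (toℕ c)) * w (suc (toℕ c)))
        ≈⟨ pairing (k ℕ.+ t) {a} {w} ℕ.≤-refl (σ^-0 k (x-column₀ t a)) ⟨
      ∑[ c < b ] (y (suc (k ℕ.+ t)) 1 (suc (toℕ c)) * Φ (D (k ℕ.+ t)) a w (suc (toℕ c)))
        ≈⟨ sum-cong-≋ {b} (λ c → *-congˡ (trans (Φ-σ^ t k 0<a {suc (toℕ c)} (s<s (Fin.toℕ<n c))) (σ^-x₀ k t (toℕ c)))) ⟩
      ∑[ c < b ] (y (suc (k ℕ.+ t)) 1 (suc (toℕ c)) * δ k (toℕ c))
        ≈⟨ ∑-δ (λ c → y (suc (k ℕ.+ t)) 1 (suc c)) k<b ⟩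
      y (suc (k ℕ.+ t)) 1 (suc k)  ∎
      where
      w : Vector
      w = σ^ k (x t a)
      b≡ : b ≡ suc (k ℕ.+ j)
      b≡ = ≡.trans (≡.sym k+j≡b) (ℕ.+-suc k j)
      k+j<b : k ℕ.+ j < b
      k+j<b = ℕ.≤-reflexive (≡.sym b≡)
      k<b : k < b
      k<b = ℕ.≤-<-trans (ℕ.m≤m+n k j) k+j<b
      top : ∀ c → y (suc (k ℕ.+ t)) (suc a) (suc (toℕ c)) ≈ δ (k ℕ.+ j) (toℕ c)
      top c = trans (y-row _ (Fin.toℕ<n c)) (reflexive (≡.cong (λ b → δ b (suc (toℕ c))) b≡))

    private
      -- (r + 1 , c + 1) and (i + 1 , j + 1) are antipodal.
      Reciprocal : ℕ → Set ℓ
      Reciprocal r = ∀ {t T c i j} → r ℕ.+ suc i ≡ a → c ℕ.+ suc j ≡ b → T ≡ suc (r ℕ.+ c ℕ.+ t) →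
        x t (suc i) (suc j) ≈ y T (suc r) (suc c)

      flip : ∀ {r} → Reciprocal r →
        ∀ {t T c i j} → r ℕ.+ suc i ≡ a → c ℕ.+ suc j ≡ b → T ≡ suc (r ℕ.+ c ℕ.+ t) →
        y t (suc i) (suc j) ≈ x T (suc r) (suc c)
      flip {r} rec {t} {T} {c} {i} {j} r+i c+j T≡ = inverse-unique (x*y≈1 t (+⇒<ʳ r+i) (+⇒<ʳ c+j))
        (trans (*-congʳ (rec r+i c+j T≡)) (trans (*-comm _ _) (x*y≈1 T (+⇒<ˡ r+i) (+⇒<ˡ c+j))))

      -- The boundary rows are antipodal too, 1̂ at column `b` answering to 0̂ at column 1. Their
      -- values do not depend on time, hence the free `t` and `T`.
      flip₀ : ∀ t T {c j} → c ℕ.+ suc j ≡ b → y t (suc a) (suc j) ≈ x T 0 (suc c)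
      flip₀ t T {c} {j} c+j = trans (y-row t (+⇒<ʳ c+j)) (trans (lemma c c+j) (sym (x-row₀ T c)))
        where
        lemma : ∀ c → c ℕ.+ suc j ≡ b → δ b (suc j) ≈ δ 0 c
        lemma zero    ≡.refl = δ-refl (suc j)
        lemma (suc c) ≡.refl = δ-< (ℕ.s≤s (ℕ.m≤n+m (suc j) c))

    -- Rows r and r + 1 yield row r + 2: evolve at a point of row r + 1 and at its antipode differ only
    -- in the pair of neighbours of which one lies in row r + 2 and the other is already known.
    reciprocal : 0 < a → ∀ r → Reciprocal r
    reciprocal 0<a zero    {t} {c = c} ≡.refl c+j ≡.refl = reciprocity-row₁ t c 0<a c+j
    reciprocal 0<a (suc r) {t} {_} {c} {i} {j} r+i c+j ≡.refl = +-cancelʳ _ _ _ (begin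
      A + B                                    ≈⟨ *-identityʳ _ ⟨
      (A + B) * 1#                             ≈⟨ *-congˡ (x*y≈1 T (+⇒<ˡ r+i′) (+⇒<ˡ c+j)) ⟨
      (A + B) * (x T (suc r) (suc c) * yT)     ≈⟨ *-assoc _ _ _ ⟨
      (A + B) * x T (suc r) (suc c) * yT       ≈⟨ *-congʳ (*-cong (+-congˡ (sym B≈)) (sym (flip ih r+i′ c+j ≡.refl))) ⟩
      (A + x t (suc (suc i)) j) * y t (suc (suc i)) (suc j) * yT
                                               ≈⟨ *-congʳ (evolve t (+⇒<ʳ r+i′) (+⇒<ʳ c+j)) ⟩
      x (suc t) (suc (suc i)) (suc j) *
        (y (suc t) (suc (suc (suc i))) (suc j) + y (suc t) (suc (suc i)) (suc (suc j))) * yT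
                                               ≈⟨ *-congʳ (*-cong (ih r+i′ c+j (time₁ r c t)) (+-cong (U≈ r r+i′ ≡.refl) (V≈ c c+j ≡.refl))) ⟩
      y (suc T) (suc r) (suc c) * (U + V) * yT ≈⟨ *-assoc _ _ _ ⟩
      y (suc T) (suc r) (suc c) * ((U + V) * yT)
                                               ≈⟨ *-congˡ (evolve T (+⇒<ˡ r+i′) (+⇒<ˡ c+j)) ⟩
      y (suc T) (suc r) (suc c) * (x (suc T) (suc r) (suc c) * (W + B))
                                               ≈⟨ cancel (x*y≈1 (suc T) (+⇒<ˡ r+i′) (+⇒<ˡ c+j)) ⟩
      W + B                                    ∎)
      where
      ih : Reciprocal r
      ih = reciprocal 0<a r
      r+i′ : r ℕ.+ suc (suc i) ≡ a
      r+i′ = ≡.trans (ℕ.+-suc r (suc i)) r+i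
      T : ℕ
      T = suc (r ℕ.+ c ℕ.+ t)
      A B U V W yT : Carrier
      A  = x t (suc i) (suc j)
      B  = y (suc T) (suc r) (suc (suc c))
      U  = x T r (suc c)
      V  = x T (suc r) c
      W  = y (suc T) (suc (suc r)) (suc c)
      yT = y T (suc r) (suc c)
      time₁ : ∀ r c t → suc (suc (r ℕ.+ c ℕ.+ t)) ≡ suc (r ℕ.+ c ℕ.+ suc t)
      time₁ = solve-∀-ℕ
      time₂ : ∀ r c t → suc (suc (r ℕ.+ c ℕ.+ t)) ≡ suc (r ℕ.+ suc c ℕ.+ t)
      time₂ = solve-∀-ℕ
      time₃ : ∀ r c t → suc (r ℕ.+ suc c ℕ.+ t) ≡ suc (r ℕ.+ c ℕ.+ suc t)
      time₃ = solve-∀-ℕ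
      -- For `j` = 0 the neighbour is missing at both places: column 0 of `x` and column `suc b` of
      -- `y` vanish.
      B≈ : x t (suc (suc i)) j ≈ B
      B≈ = go j c+j
        where
        go : ∀ j → c ℕ.+ suc j ≡ b → x t (suc (suc i)) j ≈ B
        go zero    c+1 = trans (x-column₀ t _) (sym (trans (reflexive
          (≡.cong (λ k → y (suc T) (suc r) (suc k)) (≡.trans (ℕ.+-comm 1 c) c+1))) (y-column (suc T) (+⇒<ˡ r+i′))))
        go (suc j) c+j = ih r+i′ (≡.trans (≡.sym (ℕ.+-suc c (suc j))) c+j) (time₂ r c t)
      -- Here the induction reaches back two rows; for `r` = 0 the boundary rows take over. The copy
      -- `r′` is there to be split.
      U≈ : ∀ r′ → r′ ℕ.+ suc (suc i) ≡ a → r′ ≡ r → y (suc t) (suc (suc (suc i))) (suc j) ≈ x T r′ (suc c)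
      U≈ zero     ≡.refl _      = flip₀ (suc t) T c+j
      U≈ (suc r′) r+i    ≡.refl = flip (reciprocal 0<a r′)
        (≡.trans (ℕ.+-suc r′ (suc (suc i))) r+i) c+j (time₁ r′ c t)
      V≈ : ∀ c′ → c′ ℕ.+ suc j ≡ b → c′ ≡ c → y (suc t) (suc (suc i)) (suc (suc j)) ≈ x T (suc r) c′
      V≈ zero     ≡.refl _      = trans (y-column (suc t) (+⇒<ʳ r+i′)) (sym (x-column₀ T _))
      V≈ (suc c′) c+j    ≡.refl = flip ih r+i′ (≡.trans (ℕ.+-suc c′ (suc j)) c+j) (time₃ r c′ t)
      cancel : ∀ {u v z} → u * v ≈ 1# → v * (u * z) ≈ z
      cancel uv = trans (sym (*-assoc _ _ _)) (trans (*-congʳ (trans (*-comm _ _) uv)) (*-identityˡ _))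

    reciprocity : 0 < a → ∀ {r c i j} t → r ℕ.+ suc i ≡ a → c ℕ.+ suc j ≡ b →
      x t (suc i) (suc j) * x (suc (r ℕ.+ c ℕ.+ t)) (suc r) (suc c) ≈ 1#
    reciprocity 0<a {r} t r+i c+j = trans (*-congʳ (reciprocal 0<a r r+i c+j ≡.refl))
      (trans (*-comm _ _) (x*y≈1 _ (+⇒<ˡ r+i) (+⇒<ˡ c+j)))

    -- Reciprocity is used twice: it takes r + c + 1 steps to the antipode and i + j + 1 steps back,
    -- and i + 1 + r = a, j + 1 + c = b.
    periodic : 0 < a → ∀ {i j} t → i < a → j < b →
      x (a ℕ.+ b ℕ.+ t) (suc i) (suc j) ≈ x t (suc i) (suc j)
    periodic 0<a {i} {j} t i<a j<b with ℕ.m≤n⇒∃[o]m+o≡n i<a | ℕ.m≤n⇒∃[o]m+o≡n j<b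
    ... | r , ≡.refl | c , ≡.refl = trans
      (reflexive (≡.cong (λ T → x T (suc i) (suc j)) (time i j r c t)))
      (sym (inverse-unique
        (trans (*-comm _ _) (reciprocity 0<a t (ℕ.+-comm r (suc i)) (ℕ.+-comm c (suc j))))
        (reciprocity 0<a (suc (r ℕ.+ c ℕ.+ t)) (ℕ.+-suc i r) (ℕ.+-suc j c))))
      where
      time : ∀ i j r c t → suc i ℕ.+ r ℕ.+ (suc j ℕ.+ c) ℕ.+ t ≡ suc (i ℕ.+ j ℕ.+ suc (r ℕ.+ c ℕ.+ t))
      time = solve-∀-ℕ

-- Covering relations of the rectangle

toℕ≢n : ∀ {n} (i : Fin n) → toℕ i ≢ n
toℕ≢n i = ℕ.<⇒≢ (Fin.toℕ<n i)

Prev Next : ∀ {n} → Fin n → Set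
Prev {n} i = toℕ i ≡ 0 ⊎ ∃ λ (i′ : Fin n) → toℕ i ≡ suc (toℕ i′)
Next {n} i = suc (toℕ i) ≡ n ⊎ ∃ λ (i′ : Fin n) → toℕ i′ ≡ suc (toℕ i)

prev : ∀ {n} (i : Fin n) → Prev i
prev {n} i = go (toℕ i) ≡.refl
  where
  go : ∀ m → toℕ i ≡ m → Prev i
  go zero    i≡ = inj₁ i≡
  go (suc m) i≡ = inj₂ (fromℕ< m<n , ≡.trans i≡ (≡.cong suc (≡.sym (Fin.toℕ-fromℕ< m<n))))
    where
    m<n : m < n
    m<n = ℕ.<-trans (ℕ.≤-reflexive (≡.sym i≡)) (Fin.toℕ<n i)

next : ∀ {n} (i : Fin n) → Next i
next {n} i with suc (toℕ i) ℕ.<? n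
... | yes p = inj₂ (fromℕ< p , Fin.toℕ-fromℕ< p)
... | no ¬p = inj₁ (ℕ.≤-antisym (Fin.toℕ<n i) (ℕ.≮⇒≥ ¬p))

module Covers (a b : ℕ) where

  open Rectangle a b

  infix 4 _↗_

  data _↗_ : P → P → Set where
    ↗₁ : ∀ {i i′ j} → toℕ i′ ≡ suc (toℕ i) → (i , j) ↗ (i′ , j)
    ↗₂ : ∀ {i j j′} → toℕ j′ ≡ suc (toℕ j) → (i , j) ↗ (i , j′)

  private
    step-≤ : ∀ {n} {i i′ : Fin n} → toℕ i′ ≡ suc (toℕ i) → toℕ i ≤ toℕ i′
    step-≤ eq = ℕ.≤-trans (ℕ.n≤1+n _) (ℕ.≤-reflexive (≡.sym eq))

    step-≢ : ∀ {n} {i i′ : Fin n} → toℕ i′ ≡ suc (toℕ i) → i ≢ i′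
    step-≢ eq ≡.refl = ℕ.1+n≢n (≡.sym eq)

    squeeze : ∀ {n} {i i′ k : Fin n} → toℕ i′ ≡ suc (toℕ i) →
              toℕ i ≤ toℕ k → toℕ k ≤ toℕ i′ → k ≡ i ⊎ k ≡ i′
    squeeze {i = i} {k = k} eq i≤k k≤i′ with toℕ i ℕ.≟ toℕ k
    ... | yes i≡k = inj₁ (Fin.toℕ-injective (≡.sym i≡k))
    ... | no  i≢k = inj₂ (Fin.toℕ-injective (ℕ.≤-antisym k≤i′
                      (≡.subst (ℕ._≤ toℕ k) (≡.sym eq) (ℕ.≤∧≢⇒< i≤k i≢k))))

    above : ∀ {n} {i k : Fin n} → toℕ i < toℕ k → ∃ λ (i′ : Fin n) → toℕ i′ ≡ suc (toℕ i) × toℕ i′ ≤ toℕ k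
    above {i = i} {k} i<k = fromℕ< p , Fin.toℕ-fromℕ< p , ≡.subst (ℕ._≤ toℕ k) (≡.sym (Fin.toℕ-fromℕ< p)) i<k
      where p = ℕ.≤-<-trans i<k (Fin.toℕ<n k)

  ↗⇒< : ∀ {x y} → x ↗ y → x <ᴾ y
  ↗⇒< (↗₁ eq) = (step-≤ eq , ℕ.≤-refl) , λ e → step-≢ eq (≡.cong proj₁ e)
  ↗⇒< (↗₂ eq) = (ℕ.≤-refl , step-≤ eq) , λ e → step-≢ eq (≡.cong proj₂ e)

  ↗⇒⋖ : ∀ {x y} → x ↗ y → [ x ] ⋖ [ y ]
  ↗⇒⋖ x↗y = Extrema.[ ↗⇒< x↗y ] , none x↗y
    where
    none : ∀ {x y} → x ↗ y → ∀ z → ¬ ([ x ] <̂ z × z <̂ [ y ])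
    none (↗₁ eq) [ k , l ] (Extrema.[ (i≤k , j≤l) , ≢₁ ] , Extrema.[ (k≤i′ , l≤j) , ≢₂ ])
      with Fin.toℕ-injective (ℕ.≤-antisym j≤l l≤j) | squeeze eq i≤k k≤i′
    ... | ≡.refl | inj₁ ≡.refl = ≢₁ ≡.refl
    ... | ≡.refl | inj₂ ≡.refl = ≢₂ ≡.refl
    none (↗₂ eq) [ k , l ] (Extrema.[ (i≤k , j≤l) , ≢₁ ] , Extrema.[ (k≤i , l≤j′) , ≢₂ ])
      with Fin.toℕ-injective (ℕ.≤-antisym i≤k k≤i) | squeeze eq j≤l l≤j′
    ... | ≡.refl | inj₁ ≡.refl = ≢₁ ≡.refl
    ... | ≡.refl | inj₂ ≡.refl = ≢₂ ≡.refl

  -- One step up from `x` in a coordinate where `x` and `y` differ stays weakly below `y`; as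
  -- nothing lies strictly between, that step is `y`.
  ⋖⇒↗ : ∀ {x y} → [ x ] ⋖ [ y ] → x ↗ y
  ⋖⇒↗ {k , l} {i , j} (Extrema.[ (k≤i , l≤j) , x≢y ] , none) with toℕ k ℕ.≟ toℕ i
  ... | no k≢i with above {i = k} {i} (ℕ.≤∧≢⇒< k≤i k≢i)
  ...   | k′ , eq , k′≤i with (k′ , l) ≟ᴾ (i , j)
  ...     | yes ≡.refl = ↗₁ eq
  ...     | no  ≢      = contradiction (Extrema.[ ↗⇒< (↗₁ eq) ] , Extrema.[ (k′≤i , l≤j) , ≢ ]) (none [ k′ , l ])
  ⋖⇒↗ {k , l} {i , j} (Extrema.[ (k≤i , l≤j) , x≢y ] , none)
      | yes k≡i with above {i = l} {j}
                       (ℕ.≤∧≢⇒< l≤j λ l≡j → x≢y (≡.cong₂ _,_ (Fin.toℕ-injective k≡i) (Fin.toℕ-injective l≡j)))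
  ...   | l′ , eq , l′≤j with (k , l′) ≟ᴾ (i , j)
  ...     | yes ≡.refl = ↗₂ eq
  ...     | no  ≢      = contradiction (Extrema.[ ↗⇒< (↗₂ eq) ] , Extrema.[ (k≤i , l′≤j) , ≢ ]) (none [ k , l′ ])

  ⊥⋖ : ∀ {i j} → toℕ i ≡ 0 → toℕ j ≡ 0 → ⊥± ⋖ [ i , j ]
  ⊥⋖ {i} {j} i≡0 j≡0 = ⊥±<[ _ ] , none
    where
    min : ∀ {n} {k i : Fin n} → toℕ k ≤ toℕ i → toℕ i ≡ 0 → k ≡ i
    min {k = k} k≤i eq = Fin.toℕ-injective (≡.trans
      (ℕ.n≤0⇒n≡0 (≡.subst (toℕ k ℕ.≤_) eq k≤i)) (≡.sym eq))
    none : ∀ z → ¬ (⊥± <̂ z × z <̂ [ i , j ])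
    none ⊥±        (Supremum.[ () ] , _)
    none ⊤±        (_ , ())
    none [ k , l ] (_ , Supremum.[ Infimum.[ (k≤i , l≤j) , ≢ ] ]) =
      ≢ (≡.cong₂ _,_ (min k≤i i≡0) (min l≤j j≡0))

  ⊥⋖⇒ : ∀ {i j} → ⊥± ⋖ [ i , j ] → toℕ i ≡ 0 × toℕ j ≡ 0
  ⊥⋖⇒ {i} {j} (_ , none) with prev i | prev j
  ... | inj₁ i≡0       | inj₁ j≡0       = i≡0 , j≡0
  ... | inj₂ (i′ , eq) | _              = contradiction (⊥±<[ _ ] , Extrema.[ ↗⇒< (↗₁ eq) ]) (none [ i′ , j ])
  ... | inj₁ _         | inj₂ (j′ , eq) = contradiction (⊥±<[ _ ] , Extrema.[ ↗⇒< (↗₂ eq) ]) (none [ i , j′ ])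

  ⋖⊤ : ∀ {i j} → suc (toℕ i) ≡ a → suc (toℕ j) ≡ b → [ i , j ] ⋖ ⊤±
  ⋖⊤ {i} {j} a≡ b≡ = [ _ ]<⊤± , none
    where
    max : ∀ {n} {i k : Fin n} → suc (toℕ i) ≡ n → toℕ i ≤ toℕ k → i ≡ k
    max {k = k} eq i≤k = Fin.toℕ-injective (ℕ.≤-antisym i≤k
      (s≤s⁻¹ (≡.subst (toℕ k ℕ.<_) (≡.sym eq) (Fin.toℕ<n k))))
    none : ∀ z → ¬ ([ i , j ] <̂ z × z <̂ ⊤±)
    none [ k , l ] (Extrema.[ (i≤k , j≤l) , ≢ ] , _) =
      ≢ (≡.cong₂ _,_ (max a≡ i≤k) (max b≡ j≤l))

  ⋖⊤⇒ : ∀ {i j} → [ i , j ] ⋖ ⊤± → suc (toℕ i) ≡ a × suc (toℕ j) ≡ b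
  ⋖⊤⇒ {i} {j} (_ , none) with next i | next j
  ... | inj₁ a≡        | inj₁ b≡        = a≡ , b≡
  ... | inj₂ (i′ , eq) | _              = contradiction (Extrema.[ ↗⇒< (↗₁ eq) ] , [ _ ]<⊤±) (none [ i′ , j ])
  ... | inj₁ _         | inj₂ (j′ , eq) = contradiction (Extrema.[ ↗⇒< (↗₂ eq) ] , [ _ ]<⊤±) (none [ i , j′ ])

  toList-toList⁺ : ∀ {A : Set} {x : A} xs (p : x ∈ xs) → List⁺.toList (toList⁺ xs p) ≡ xs
  toList-toList⁺ (x ∷ xs) p = ≡.refl

  lowers : ∀ {i j} → Prev i → Prev j → List P̂
  lowers         (inj₁ _)        (inj₁ _)        = ⊥± ∷ []
  lowers {i}     (inj₁ _)        (inj₂ (j′ , _)) = [ i , j′ ] ∷ []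
  lowers {j = j} (inj₂ (i′ , _)) (inj₁ _)        = [ i′ , j ] ∷ []
  lowers {i} {j} (inj₂ (i′ , _)) (inj₂ (j′ , _)) = [ i′ , j ] ∷ [ i , j′ ] ∷ []

  uppers : ∀ {i j} → Next i → Next j → List P̂
  uppers         (inj₁ _)        (inj₁ _)        = ⊤± ∷ []
  uppers {i}     (inj₁ _)        (inj₂ (j′ , _)) = [ i , j′ ] ∷ []
  uppers {j = j} (inj₂ (i′ , _)) (inj₁ _)        = [ i′ , j ] ∷ []
  uppers {i} {j} (inj₂ (i′ , _)) (inj₂ (j′ , _)) = [ i′ , j ] ∷ [ i , j′ ] ∷ []

  private
    singleton : ∀ {z : P̂} → Unique (z ∷ [])
    singleton = [] ∷ []

    suc-injective : ∀ {n} {i k : Fin n} {m} → m ≡ suc (toℕ i) → m ≡ suc (toℕ k) → i ≡ k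
    suc-injective eq eq′ = Fin.toℕ-injective (ℕ.suc-injective (≡.trans (≡.sym eq) eq′))

  lowers-unique : ∀ {i j} (p : Prev i) (q : Prev j) → Unique (lowers p q)
  lowers-unique (inj₁ _)        (inj₁ _)        = singleton
  lowers-unique (inj₁ _)        (inj₂ _)        = singleton
  lowers-unique (inj₂ _)        (inj₁ _)        = singleton
  lowers-unique (inj₂ (_ , eq)) (inj₂ _) = ((λ { ≡.refl → ℕ.1+n≢n (≡.sym eq) }) ∷ []) ∷ singleton

  uppers-unique : ∀ {i j} (p : Next i) (q : Next j) → Unique (uppers p q)
  uppers-unique (inj₁ _)        (inj₁ _)        = singleton
  uppers-unique (inj₁ _)        (inj₂ _)        = singleton
  uppers-unique (inj₂ _)        (inj₁ _)        = singleton
  uppers-unique (inj₂ (_ , eq)) (inj₂ _) = ((λ { ≡.refl → ℕ.1+n≢n (≡.sym eq) }) ∷ []) ∷ singleton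

  lowers-⋖ : ∀ {i j} (p : Prev i) (q : Prev j) → All (_⋖ [ i , j ]) (lowers p q)
  lowers-⋖ (inj₁ i≡0)      (inj₁ j≡0)      = ⊥⋖ i≡0 j≡0 ∷ []
  lowers-⋖ (inj₁ _)        (inj₂ (_ , eq)) = ↗⇒⋖ (↗₂ eq) ∷ []
  lowers-⋖ (inj₂ (_ , eq)) (inj₁ _)        = ↗⇒⋖ (↗₁ eq) ∷ []
  lowers-⋖ (inj₂ (_ , eq)) (inj₂ (_ , eq′)) = ↗⇒⋖ (↗₁ eq) ∷ ↗⇒⋖ (↗₂ eq′) ∷ []

  uppers-⋖ : ∀ {i j} (p : Next i) (q : Next j) → All ([ i , j ] ⋖_) (uppers p q)
  uppers-⋖ (inj₁ a≡)       (inj₁ b≡)       = ⋖⊤ a≡ b≡ ∷ []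
  uppers-⋖ (inj₁ _)        (inj₂ (_ , eq)) = ↗⇒⋖ (↗₂ eq) ∷ []
  uppers-⋖ (inj₂ (_ , eq)) (inj₁ _)        = ↗⇒⋖ (↗₁ eq) ∷ []
  uppers-⋖ (inj₂ (_ , eq)) (inj₂ (_ , eq′)) = ↗⇒⋖ (↗₁ eq) ∷ ↗⇒⋖ (↗₂ eq′) ∷ []

  ∈-lowers : ∀ {i j} (p : Prev i) (q : Prev j) {z} → z ⋖ [ i , j ] → z ∈ lowers p q
  ∈-lowers p q {⊤±} (() , _)
  ∈-lowers (inj₁ _) (inj₁ _) {⊥±} _ = here ≡.refl
  ∈-lowers (inj₁ _) (inj₂ (_ , eq)) {⊥±} z⋖ with () ← ≡.trans (≡.sym eq) (proj₂ (⊥⋖⇒ z⋖))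
  ∈-lowers (inj₂ (_ , eq)) _ {⊥±} z⋖ with () ← ≡.trans (≡.sym eq) (proj₁ (⊥⋖⇒ z⋖))
  ∈-lowers p q {[ x ]} z⋖ = go p q (⋖⇒↗ z⋖)
    where
    go : ∀ {x i j} (p : Prev i) (q : Prev j) → x ↗ (i , j) → [ x ] ∈ lowers p q
    go (inj₁ i≡0)      _               (↗₁ eq) with () ← ≡.trans (≡.sym eq) i≡0
    go (inj₂ (_ , e))  (inj₁ _)        (↗₁ eq) with ≡.refl ← suc-injective e eq = here ≡.refl
    go (inj₂ (_ , e))  (inj₂ _)        (↗₁ eq) with ≡.refl ← suc-injective e eq = here ≡.refl
    go _               (inj₁ j≡0)      (↗₂ eq) with () ← ≡.trans (≡.sym eq) j≡0
    go (inj₁ _)        (inj₂ (_ , e))  (↗₂ eq) with ≡.refl ← suc-injective e eq = here ≡.refl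
    go (inj₂ _)        (inj₂ (_ , e))  (↗₂ eq) with ≡.refl ← suc-injective e eq = there (here ≡.refl)

  ∈-uppers : ∀ {i j} (p : Next i) (q : Next j) {z} → [ i , j ] ⋖ z → z ∈ uppers p q
  ∈-uppers p q {⊥±} (Supremum.[ () ] , _)
  ∈-uppers (inj₁ _) (inj₁ _) {⊤±} _ = here ≡.refl
  ∈-uppers (inj₁ _) (inj₂ (j′ , eq)) {⊤±} z⋖ =
    contradiction (≡.trans eq (proj₂ (⋖⊤⇒ z⋖))) (toℕ≢n j′)
  ∈-uppers (inj₂ (i′ , eq)) _ {⊤±} z⋖ =
    contradiction (≡.trans eq (proj₁ (⋖⊤⇒ z⋖))) (toℕ≢n i′)
  ∈-uppers p q {[ x ]} z⋖ = go p q (⋖⇒↗ z⋖)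
    where
    go : ∀ {x i j} (p : Next i) (q : Next j) → (i , j) ↗ x → [ x ] ∈ uppers p q
    go (inj₁ a≡)       _               (↗₁ {i′ = i′} eq) = contradiction (≡.trans eq a≡) (toℕ≢n i′)
    go (inj₂ (_ , e))  (inj₁ _)        (↗₁ eq) with ≡.refl ← Fin.toℕ-injective (≡.trans e (≡.sym eq)) = here ≡.refl
    go (inj₂ (_ , e))  (inj₂ _)        (↗₁ eq) with ≡.refl ← Fin.toℕ-injective (≡.trans e (≡.sym eq)) = here ≡.refl
    go _               (inj₁ b≡)       (↗₂ {j′ = j′} eq) = contradiction (≡.trans eq b≡) (toℕ≢n j′)
    go (inj₁ _)        (inj₂ (_ , e))  (↗₂ eq) with ≡.refl ← Fin.toℕ-injective (≡.trans e (≡.sym eq)) = here ≡.refl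
    go (inj₂ _)        (inj₂ (_ , e))  (↗₂ eq) with ≡.refl ← Fin.toℕ-injective (≡.trans e (≡.sym eq)) = there (here ≡.refl)

  elementŝ-unique : Unique elementŝ
  elementŝ-unique =
    ((λ ()) ∷ All.map⁺ (All.universal (λ _ ()) elements)) ∷
    (All.map⁺ (All.universal (λ _ ()) elements) ∷
    Unique.map⁺ [_]-injective (Unique.cartesianProduct⁺ (Unique.allFin⁺ a) (Unique.allFin⁺ b)))

  -- Both lists are free of duplicates and have the same members. A permutation is enough, since the
  -- lists are only summed over.
  lowers-↭ : ∀ i j → List⁺.toList ((i , j) ⁻) ↭ lowers (prev i) (prev j)
  lowers-↭ i j = ≡.subst (_↭ lowers (prev i) (prev j)) (≡.sym (toList-toList⁺ (filter (_⋖? [ i , j ]) elementŝ) _))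
    (∼bag⇒↭ (unique∧set⇒bag (Unique.filter⁺ (_⋖? [ i , j ]) elementŝ-unique) (lowers-unique (prev i) (prev j))
      (mk⇔ (λ z∈ → ∈-lowers (prev i) (prev j) (proj₂ (∈-filter⁻ (_⋖? [ i , j ]) {xs = elementŝ} z∈)))
           (λ z∈ → ∈-filter⁺ (_⋖? [ i , j ]) (∈-elementŝ _) (All.lookup (lowers-⋖ (prev i) (prev j)) z∈)))))

  uppers-↭ : ∀ i j → List⁺.toList ((i , j) ⁺) ↭ uppers (next i) (next j)
  uppers-↭ i j = ≡.subst (_↭ uppers (next i) (next j)) (≡.sym (toList-toList⁺ (filter ([ i , j ] ⋖?_) elementŝ) _))
    (∼bag⇒↭ (unique∧set⇒bag (Unique.filter⁺ ([ i , j ] ⋖?_) elementŝ-unique) (uppers-unique (next i) (next j))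
      (mk⇔ (λ z∈ → ∈-uppers (next i) (next j) (proj₂ (∈-filter⁻ ([ i , j ] ⋖?_) {xs = elementŝ} z∈)))
           (λ z∈ → ∈-filter⁺ ([ i , j ] ⋖?_) (∈-elementŝ _) (All.lookup (uppers-⋖ (next i) (next j)) z∈)))))

-- Composites of toggles

module ToggleSequences {c ℓ₁ ℓ₂} (R : Reals c ℓ₁ ℓ₂) (a b : ℕ) where

  open Birational R a b

  τ-≢ : ∀ x f {y} → y ≢ x → τ x f y ≡ f y
  τ-≢ x f {y} y≢x with y ≟ᴾ x
  ... | yes y≡x = contradiction y≡x y≢x
  ... | no  _   = ≡.refl

  compose-∉ : ∀ zs f {y} → y ∉ zs → compose (List.map τ zs) f y ≡ f y
  compose-∉ []       f y∉ = ≡.refl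
  compose-∉ (z ∷ zs) f y∉ =
    ≡.trans (τ-≢ z (compose (List.map τ zs) f) (y∉ ∘ here)) (compose-∉ zs f (y∉ ∘ there))

  -- h is the labeling at the moment x is toggled on the way from f to g: the y ≺ x still have their
  -- old values, the y ≻ x already have their new ones.
  Update : ∀ {ℓ} → Rel P ℓ → Labeling → Labeling → P → Set _
  Update _≺_ f g x = ∃ λ h →
    g x ≡ τ x h x × h x ≡ f x × (∀ {y} → y ≺ x → h y ≡ f y) × (∀ {y} → x ≺ y → h y ≡ g y)

  -- Lists compose from their right end, so what follows `x` is toggled before it. The order
  -- condition keeps each y ≺ x out of that tail and each y ≻ x out of the part preceding `x`;
  -- distinctness lets `x` change only once.
  update : ∀ {ℓ} (_≺_ : Rel P ℓ) → (∀ {x y} → x ≺ y → y ≢ x) →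
    ∀ {zs} → AllPairs (λ x y → x ≢ y × ¬ (y ≺ x)) zs → ∀ f {x} → x ∈ zs →
    Update _≺_ f (compose (List.map τ zs) f) x
  update _≺_ irrefl {x ∷ zs} (x< ∷ _) f (here ≡.refl) =
    compose (List.map τ zs) f , ≡.refl ,
    compose-∉ zs f (λ x∈zs → proj₁ (All.lookup x< x∈zs) ≡.refl) ,
    (λ y≺x → compose-∉ zs f (λ y∈zs → proj₂ (All.lookup x< y∈zs) y≺x)) ,
    (λ x≺y → ≡.sym (τ-≢ x (compose (List.map τ zs) f) (irrefl x≺y)))
  update _≺_ irrefl {z ∷ zs} (z< ∷ zs<) f (there x∈zs) with update _≺_ irrefl zs< f x∈zs
  ... | h , gx , hx , below , above =
    h , ≡.trans (τ-≢ z g′ (λ { ≡.refl → proj₁ (All.lookup z< x∈zs) ≡.refl })) gx , hx , below ,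
    (λ x≺y → ≡.trans (above x≺y) (≡.sym (τ-≢ z g′ (λ { ≡.refl → proj₂ (All.lookup z< x∈zs) x≺y }))))
    where
    g′ : Labeling
    g′ = compose (List.map τ zs) f

  -- This is j - i + a in coordinates counted from 1; the truncated subtraction is exact because
  -- `toℕ i < a`.
  fileIndex : P → ℕ
  fileIndex (i , j) = toℕ j ℕ.+ (a ∸ toℕ i)

  private
    index-+ : ∀ x → suc (toℕ (proj₂ x)) ℕ.+ a ≡ fileIndex x ℕ.+ suc (toℕ (proj₁ x))
    index-+ (i , j) = ≡.trans
      (≡.cong (suc (toℕ j) ℕ.+_) (≡.sym (ℕ.m∸n+n≡m (ℕ.<⇒≤ (Fin.toℕ<n i)))))
      (≡.trans (≡.cong suc (≡.sym (ℕ.+-assoc (toℕ j) (a ∸ toℕ i) (toℕ i))))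
        (≡.sym (ℕ.+-suc (fileIndex (i , j)) (toℕ i))))

  InFile⇒ : ∀ k x → InFile k x → fileIndex x ≡ k
  InFile⇒ k (i , j) eq = ℕ.+-cancelʳ-≡ (suc (toℕ i)) _ _ (≡.trans (≡.sym (index-+ (i , j))) eq)

  InFile⇐ : ∀ k x → fileIndex x ≡ k → InFile k x
  InFile⇐ k x ≡.refl = index-+ x

  sweep : ℕ → List P
  sweep m = concatMap (file ∘ suc) (downFrom m)

  file-all : ∀ k → All (λ x → fileIndex x ≡ k) (file k)
  file-all k = All.map (λ {x} → InFile⇒ k x)
    (All.all-filter (λ (i , j) → suc (toℕ j) ℕ.+ a ℕ.≟ k ℕ.+ suc (toℕ i)) elements)

  sweep-≤ : ∀ m → All (λ x → fileIndex x ≤ m) (sweep m)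
  sweep-≤ zero    = []
  sweep-≤ (suc m) = All.++⁺ (All.map ℕ.≤-reflexive (file-all (suc m))) (All.map ℕ.m≤n⇒m≤1+n (sweep-≤ m))

  -- Promotion toggles the files in increasing order, so y ≺ x means that x is toggled before y.
  _≺_ : Rel P _
  y ≺ x = fileIndex x < fileIndex y

  -- Members of one file are incomparable under `_≺_`, so only the order of the files matters.
  sweep-ordered : ∀ m → AllPairs (λ x y → x ≢ y × ¬ (y ≺ x)) (sweep m)
  sweep-ordered zero    = []
  sweep-ordered (suc m) = AllPairs.++⁺ (AllPairs.zip (file-unique , within (file-all (suc m)))) (sweep-ordered m)
    (All.map (λ x≡ → All.map (λ y≤ → between x≡ y≤) (sweep-≤ m)) (file-all (suc m)))
    where
    file-unique : AllPairs _≢_ (file (suc m))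
    file-unique = Unique.filter⁺ _ (Unique.cartesianProduct⁺ (Unique.allFin⁺ a) (Unique.allFin⁺ b))
    within : ∀ {k zs} → All (λ x → fileIndex x ≡ k) zs → AllPairs (λ x y → ¬ (y ≺ x)) zs
    within []       = []
    within (p ∷ ps) = All.map (λ q → ℕ.<-irrefl (≡.trans p (≡.sym q))) ps ∷ within ps
    between : ∀ {x y} → fileIndex x ≡ suc m → fileIndex y ≤ m → x ≢ y × ¬ (y ≺ x)
    between x≡ y≤ = (λ { ≡.refl → ℕ.1+n≰n (≡.subst (ℕ._≤ m) x≡ y≤) }) ,
      (λ x<y → ℕ.<-asym x<y (ℕ.≤-trans (s≤s y≤) (ℕ.≤-reflexive (≡.sym x≡))))

  ∈-sweep : ∀ {x} m → 0 < fileIndex x → fileIndex x ≤ m → x ∈ sweep m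
  ∈-sweep {x} zero    0<  ≤m = contradiction (ℕ.<-≤-trans 0< ≤m) ℕ.n≮0
  ∈-sweep {x} (suc m) 0<  ≤m with fileIndex x ℕ.≟ suc m
  ... | yes eq = ∈-++⁺ˡ (∈-filter⁺ (λ (i , j) → suc (toℕ j) ℕ.+ a ℕ.≟ suc m ℕ.+ suc (toℕ i))
                   (∈-elements x) (InFile⇐ (suc m) x eq))
  ... | no ≢m  = ∈-++⁺ʳ (file (suc m)) (∈-sweep m 0< (s≤s⁻¹ (ℕ.≤∧≢⇒< ≤m ≢m)))

  ∈-sweep-all : ∀ x → x ∈ sweep (n ∸ 1)
  ∈-sweep-all (i , j) = ∈-sweep (n ∸ 1)
    (ℕ.<-≤-trans (ℕ.m<n⇒0<n∸m (Fin.toℕ<n i)) (ℕ.m≤n+m (a ∸ toℕ i) (toℕ j)))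
    (ℕ.∸-monoˡ-≤ 1 (ℕ.≤-trans (ℕ.+-mono-≤ (Fin.toℕ<n j) (ℕ.m∸n≤m a (toℕ i))) (ℕ.≤-reflexive (ℕ.+-comm b a))))

  promotion-sweep : ∀ f → promotion f ≡ compose (List.map τ (sweep (n ∸ 1))) f
  promotion-sweep f = go (n ∸ 1)
    where
    compose-++ : ∀ xs {ys} → compose (List.map τ (xs ++ ys)) f ≡ compose (List.map τ xs) (compose (List.map τ ys) f)
    compose-++ []       = ≡.refl
    compose-++ (x ∷ xs) = ≡.cong (τ x) (compose-++ xs)
    go : ∀ m → compose (List.map (τ* ∘ suc) (downFrom m)) f ≡ compose (List.map τ (sweep m)) f
    go zero    = ≡.refl
    go (suc m) = ≡.trans (≡.cong (τ* (suc m)) (go m)) (≡.sym (compose-++ (file (suc m))))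

  rowmotion-update : ∀ {xs} → IsLinearExtension xs → ∀ f x → Update _<ᴾ_ f (rowmotion xs f) x
  rowmotion-update lin f x = update _<ᴾ_ (λ x<y y≡x → proj₂ x<y (≡.sym y≡x))
    (AllPairs.zip (unique , ordered)) f (covers x)
    where open IsLinearExtension lin

  promotion-update : ∀ f x → Update _≺_ f (promotion f) x
  promotion-update f x = ≡.subst (λ g → Update _≺_ f g x) (≡.sym (promotion-sweep f))
    (update _≺_ (λ x≺y → λ { ≡.refl → ℕ.<-irrefl ≡.refl x≺y }) (sweep-ordered (n ∸ 1)) f (∈-sweep-all x))

-- From labelings to arrays: the recurrence for rowmotion and promotion

module Arrays {c ℓ₁ ℓ₂} (R : Reals c ℓ₁ ℓ₂) (a b : ℕ) where

  open Reals R hiding (_<_; _≤_)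
  open Birational R a b
  open Covers a b
  open ToggleSequences R a b
  open RowmotionArrays commutativeRing using (δ; δ-refl; δ-<; RowmotionArray; inverse-unique)
  open SetoidReasoning setoid
  open SemiringSolver commutativeSemiring using (solve; _:=_; _:+_; _:*_)

  Array : Set _
  Array = ℕ → ℕ → ℝ⁺

  *-⁻¹ : ∀ s → proj₁ s * proj₁ (s ⁻¹) ≈ 1#
  *-⁻¹ (_ , p) = proj₂ (proj₂ (inverse p))

  -- The labeling as an array indexed from 0, with the value 1 outside the rectangle.
  at : Labeling → Array
  at f i j with i ℕ.<? a | j ℕ.<? b
  ... | yes p | yes q = f (fromℕ< p , fromℕ< q)
  ... | yes _ | no  _ = 1⁺
  ... | no  _ | _     = 1⁺

  at-toℕ : ∀ f i j → at f (toℕ i) (toℕ j) ≡ f (i , j)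
  at-toℕ f i j with toℕ i ℕ.<? a | toℕ j ℕ.<? b
  ... | yes p | yes q = ≡.cong₂ (λ i j → f (i , j)) (Fin.fromℕ<-toℕ i p) (Fin.fromℕ<-toℕ j q)
  ... | yes _ | no ¬q = contradiction (Fin.toℕ<n j) ¬q
  ... | no ¬p | _     = contradiction (Fin.toℕ<n i) ¬p

  -- The boundary conventions are those of RowmotionArray, with indices from 1 whereas F starts at 0.
  x̂ ŷ : Array → ℕ → ℕ → Carrier
  x̂ F i       zero    = 0#
  x̂ F zero    (suc j) = δ 0 j
  x̂ F (suc i) (suc j) = proj₁ (F i j)
  ŷ F zero    j       = 0#
  ŷ F (suc i) zero    = 0#
  ŷ F (suc i) (suc j) with i ℕ.<? a | j ℕ.<? b
  ... | yes _ | yes _ = proj₁ (F i j ⁻¹)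
  ... | yes _ | no  _ = 0#
  ... | no  _ | _     = δ b (suc j)

  ⁻¹-cong : ∀ {s t} → proj₁ s ≈ proj₁ t → proj₁ (s ⁻¹) ≈ proj₁ (t ⁻¹)
  ⁻¹-cong {s} {t} s≈t = inverse-unique (*-⁻¹ s) (trans (*-congʳ s≈t) (*-⁻¹ t))

  x̂-cong : ∀ {F G} i j →
    (∀ {i′ j′} → i ≡ suc i′ → j ≡ suc j′ → proj₁ (F i′ j′) ≈ proj₁ (G i′ j′)) → x̂ F i j ≈ x̂ G i j
  x̂-cong i       zero    eq = refl
  x̂-cong zero    (suc j) eq = refl
  x̂-cong (suc i) (suc j) eq = eq ≡.refl ≡.refl

  ŷ-cong : ∀ {F G} i j →
    (∀ {i′ j′} → i ≡ suc i′ → j ≡ suc j′ → i′ < a → j′ < b → proj₁ (F i′ j′) ≈ proj₁ (G i′ j′)) →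
    ŷ F i j ≈ ŷ G i j
  ŷ-cong zero    j       eq = refl
  ŷ-cong (suc i) zero    eq = refl
  ŷ-cong {F} {G} (suc i) (suc j) eq with i ℕ.<? a | j ℕ.<? b
  ... | yes p | yes q = ⁻¹-cong {F i j} {G i j} (eq ≡.refl ≡.refl p q)
  ... | yes _ | no  _ = refl
  ... | no  _ | _     = refl

  ŷ-in : ∀ {F i j} → i < a → j < b → ŷ F (suc i) (suc j) ≡ proj₁ (F i j ⁻¹)
  ŷ-in {i = i} {j} p q with i ℕ.<? a | j ℕ.<? b
  ... | yes _ | yes _ = ≡.refl
  ... | yes _ | no ¬q = contradiction q ¬q
  ... | no ¬p | _     = contradiction p ¬p

  ŷ-column : ∀ {F i} → i < a → ŷ F (suc i) (suc b) ≡ 0#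
  ŷ-column {i = i} p with i ℕ.<? a | b ℕ.<? b
  ... | yes _ | yes q = contradiction q (ℕ.<-irrefl ≡.refl)
  ... | yes _ | no  _ = ≡.refl
  ... | no ¬p | _     = contradiction p ¬p

  ŷ-row : ∀ {F} j → ŷ F (suc a) (suc j) ≡ δ b (suc j)
  ŷ-row j with a ℕ.<? a
  ... | yes p = contradiction p (ℕ.<-irrefl ≡.refl)
  ... | no  _ = ≡.refl

  module _ {A : Set} where

    ∑ₗ : (A → Carrier) → List A → Carrier
    ∑ₗ e = List.foldr (λ z s → e z + s) 0#

    ∑ₗ-↭ : ∀ e {zs ws} → zs ↭ ws → ∑ₗ e zs ≈ ∑ₗ e ws
    ∑ₗ-↭ e Perm.refl         = refl
    ∑ₗ-↭ e (Perm.prep z p)   = +-congˡ (∑ₗ-↭ e p)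
    ∑ₗ-↭ e (Perm.swap z w p) = trans (sym (+-assoc _ _ _))
      (trans (+-cong (+-comm _ _) (∑ₗ-↭ e p)) (+-assoc _ _ _))
    ∑ₗ-↭ e (Perm.trans p q)  = trans (∑ₗ-↭ e p) (∑ₗ-↭ e q)

    ∑⁺-map : ∀ (g : A → ℝ⁺) zs → proj₁ (∑⁺ (List⁺.map g zs)) ≈ ∑ₗ (λ z → proj₁ (g z)) (List⁺.toList zs)
    ∑⁺-map g (z ∷ zs) = go z zs
      where
      go : ∀ z zs → proj₁ (∑⁺ (List⁺.map g (z ∷ zs))) ≈ ∑ₗ (λ z → proj₁ (g z)) (z ∷ zs)
      go z []       = sym (+-identityʳ _)
      go z (w ∷ zs) = +-congˡ (go w zs)

  -- The neighbour in the same column is read in `F`, the one in the same row in `G`: rowmotion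
  -- reads both at one time, promotion reads one before and the other after the step.
  lowSum upSum : Array → Array → ℕ → ℕ → Carrier
  lowSum F G i j = x̂ F i (suc j) + x̂ G (suc i) j
  upSum  F G i j = ŷ F (suc (suc i)) (suc j) + ŷ G (suc i) (suc (suc j))

  ∑⁺-lower : ∀ f i j → proj₁ (∑⁺ (List⁺.map (extend f) ((i , j) ⁻))) ≈ lowSum (at f) (at f) (toℕ i) (toℕ j)
  ∑⁺-lower f i j = trans (∑⁺-map (extend f) ((i , j) ⁻))
    (trans (∑ₗ-↭ (λ z → proj₁ (extend f z)) (lowers-↭ i j)) (go (prev i) (prev j)))
    where
    go : (p : Prev i) (q : Prev j) →
      ∑ₗ (λ z → proj₁ (extend f z)) (lowers p q) ≈ lowSum (at f) (at f) (toℕ i) (toℕ j)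
    go (inj₁ i≡) (inj₁ j≡) rewrite i≡ | j≡ = refl
    go (inj₁ i≡) (inj₂ (j′ , j≡)) rewrite i≡ | j≡ = trans (+-comm _ _)
      (+-congˡ (reflexive (≡.cong proj₁ (≡.sym (≡.trans (≡.cong (λ k → at f k (toℕ j′)) (≡.sym i≡)) (at-toℕ f i j′))))))
    go (inj₂ (i′ , i≡)) (inj₁ j≡) rewrite i≡ | j≡ = 
      (+-congʳ (reflexive (≡.cong proj₁ (≡.sym (≡.trans (≡.cong (at f (toℕ i′)) (≡.sym j≡)) (at-toℕ f i′ j))))))
    go (inj₂ (i′ , i≡)) (inj₂ (j′ , j≡)) = trans (+-congˡ (+-identityʳ _)) (+-cong
      (reflexive (≡.trans (≡.cong proj₁ (≡.sym (at-toℕ f i′ j))) (≡.cong (λ k → x̂ (at f) k (suc (toℕ j))) (≡.sym i≡))))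
      (reflexive (≡.trans (≡.cong proj₁ (≡.sym (at-toℕ f i j′))) (≡.cong (x̂ (at f) (suc (toℕ i))) (≡.sym j≡)))))

  ∑⁺-upper : ∀ f i j → proj₁ (∑⁺ (List⁺.map _⁻¹ (List⁺.map (extend f) ((i , j) ⁺)))) ≈
    upSum (at f) (at f) (toℕ i) (toℕ j)
  ∑⁺-upper f i j = trans (reflexive (≡.cong (λ zs → proj₁ (∑⁺ zs)) (≡.sym (map-∘ ((i , j) ⁺)))))
    (trans (∑⁺-map (λ z → extend f z ⁻¹) ((i , j) ⁺))
    (trans (∑ₗ-↭ (λ z → proj₁ (extend f z ⁻¹)) (uppers-↭ i j)) (go (next i) (next j))))
    where
    map-∘ : ∀ (zs : List⁺ P̂) → List⁺.map (λ z → extend f z ⁻¹) zs ≡ List⁺.map _⁻¹ (List⁺.map (extend f) zs)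
    map-∘ (z ∷ zs) = ≡.cong (_ ∷_) (List.map-∘ zs)
    1⁻¹ : proj₁ (1⁺ ⁻¹) ≈ 1#
    1⁻¹ = trans (sym (*-identityˡ _)) (*-⁻¹ 1⁺)
    value : ∀ i j → proj₁ (f (i , j) ⁻¹) ≡ ŷ (at f) (suc (toℕ i)) (suc (toℕ j))
    value i j = ≡.trans (≡.cong (λ s → proj₁ (s ⁻¹)) (≡.sym (at-toℕ f i j)))
      (≡.sym (ŷ-in (Fin.toℕ<n i) (Fin.toℕ<n j)))
    row-end : suc (toℕ i) ≡ a → ∀ j → ŷ (at f) (suc (suc (toℕ i))) (suc j) ≡ δ b (suc j)
    row-end i≡ j = ≡.trans (≡.cong (λ k → ŷ (at f) (suc k) (suc j)) i≡) (ŷ-row j)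
    column-end : suc (toℕ j) ≡ b → ŷ (at f) (suc (toℕ i)) (suc (suc (toℕ j))) ≡ 0#
    column-end j≡ = ≡.trans (≡.cong (λ k → ŷ (at f) (suc (toℕ i)) (suc k)) j≡) (ŷ-column (Fin.toℕ<n i))
    go : (p : Next i) (q : Next j) →
      ∑ₗ (λ z → proj₁ (extend f z ⁻¹)) (uppers p q) ≈ upSum (at f) (at f) (toℕ i) (toℕ j)
    go (inj₁ i≡) (inj₁ j≡) = +-cong
      (trans 1⁻¹ (sym (trans (reflexive (≡.trans (row-end i≡ (toℕ j)) (≡.cong (δ b) j≡))) (δ-refl b))))
      (reflexive (≡.sym (column-end j≡)))
    go (inj₁ i≡) (inj₂ (j′ , j≡)) = trans (+-comm _ _) (+-cong
      (sym (trans (reflexive (row-end i≡ (toℕ j)))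
        (δ-< (≡.subst (_< b) j≡ (Fin.toℕ<n j′)))))
      (reflexive (≡.trans (value i j′) (≡.cong (λ k → ŷ (at f) (suc (toℕ i)) (suc k)) j≡))))
    go (inj₂ (i′ , i≡)) (inj₁ j≡) = +-cong
      (reflexive (≡.trans (value i′ j) (≡.cong (λ k → ŷ (at f) (suc k) (suc (toℕ j))) i≡)))
      (reflexive (≡.sym (column-end j≡)))
    go (inj₂ (i′ , i≡)) (inj₂ (j′ , j≡)) = trans (+-congˡ (+-identityʳ _)) (+-cong
      (reflexive (≡.trans (value i′ j) (≡.cong (λ k → ŷ (at f) (suc k) (suc (toℕ j))) i≡)))
      (reflexive (≡.trans (value i j′) (≡.cong (λ k → ŷ (at f) (suc (toℕ i)) (suc k)) j≡))))

  -- The last factor of the toggle is the reciprocal of the sum on the right, so multiplying by that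
  -- sum clears the parallel sum.
  toggle : ∀ h i j →
    lowSum (at h) (at h) (toℕ i) (toℕ j) * proj₁ (h (i , j) ⁻¹) ≈
    proj₁ (τ (i , j) h (i , j)) * upSum (at h) (at h) (toℕ i) (toℕ j)
  toggle h i j with (i , j) ≟ᴾ (i , j)
  ... | no  ≢ = contradiction ≡.refl ≢
  ... | yes _ = begin
    lowSum (at h) (at h) (toℕ i) (toℕ j) * u  ≈⟨ *-congʳ (∑⁺-lower h i j) ⟨
    proj₁ s * u                    ≈⟨ *-identityʳ _ ⟨
    proj₁ s * u * 1#               ≈⟨ *-congˡ (*-⁻¹ t) ⟨
    proj₁ s * u * (proj₁ t * proj₁ (t ⁻¹))
      ≈⟨ solve 4 (λ s u t t′ → s :* u :* (t :* t′) := u :* s :* t′ :* t) refl (proj₁ s) u (proj₁ t) (proj₁ (t ⁻¹)) ⟩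
    u * proj₁ s * proj₁ (t ⁻¹) * proj₁ t
      ≈⟨ *-congˡ (∑⁺-upper h i j) ⟩
    u * proj₁ s * proj₁ (t ⁻¹) * upSum (at h) (at h) (toℕ i) (toℕ j)  ∎
    where
    s t : ℝ⁺
    s = ∑⁺ (List⁺.map (extend h) ((i , j) ⁻))
    t = ∑⁺ (List⁺.map _⁻¹ (List⁺.map (extend h) ((i , j) ⁺)))
    u : Carrier
    u = proj₁ (h (i , j) ⁻¹)

  at-cong : ∀ {f h} i j → (∀ k l → toℕ k ≡ i → toℕ l ≡ j → h (k , l) ≡ f (k , l)) →
    proj₁ (at h i j) ≈ proj₁ (at f i j)
  at-cong i j eq with i ℕ.<? a | j ℕ.<? b
  ... | yes p | yes q = reflexive (≡.cong proj₁ (eq _ _ (Fin.toℕ-fromℕ< p) (Fin.toℕ-fromℕ< q)))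
  ... | yes _ | no  _ = refl
  ... | no  _ | _     = refl

  module _ (f h : Labeling) (i : Fin a) (j : Fin b) where

    private
      injective : ∀ {n} {k l : Fin n} {m} → toℕ k ≡ m → suc (toℕ l) ≡ suc m → k ≡ l
      injective k≡ l≡ = Fin.toℕ-injective (≡.trans k≡ (≡.sym (ℕ.suc-injective l≡)))
      successor : ∀ {k l m} → l ≡ suc m → k ≡ m → l ≡ suc k
      successor l≡ k≡ = ≡.trans l≡ (≡.cong suc (≡.sym k≡))

    x̂-above : (∀ {k} → toℕ i ≡ suc (toℕ k) → h (k , j) ≡ f (k , j)) →
      x̂ (at h) (toℕ i) (suc (toℕ j)) ≈ x̂ (at f) (toℕ i) (suc (toℕ j))
    x̂-above eq = x̂-cong {at h} {at f} (toℕ i) (suc (toℕ j)) (λ i≡ j≡ → at-cong _ _ λ k l k≡ l≡ →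
      ≡.subst (λ l → h (k , l) ≡ f (k , l)) (≡.sym (injective l≡ j≡)) (eq (successor i≡ k≡)))

    x̂-left : (∀ {l} → toℕ j ≡ suc (toℕ l) → h (i , l) ≡ f (i , l)) →
      x̂ (at h) (suc (toℕ i)) (toℕ j) ≈ x̂ (at f) (suc (toℕ i)) (toℕ j)
    x̂-left eq = x̂-cong {at h} {at f} (suc (toℕ i)) (toℕ j) (λ i≡ j≡ → at-cong _ _ λ k l k≡ l≡ →
      ≡.subst (λ k → h (k , l) ≡ f (k , l)) (≡.sym (injective k≡ i≡)) (eq (successor j≡ l≡)))

    ŷ-below : (∀ {k} → toℕ k ≡ suc (toℕ i) → h (k , j) ≡ f (k , j)) →
      ŷ (at h) (suc (suc (toℕ i))) (suc (toℕ j)) ≈ ŷ (at f) (suc (suc (toℕ i))) (suc (toℕ j))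
    ŷ-below eq = ŷ-cong {at h} {at f} (suc (suc (toℕ i))) (suc (toℕ j)) (λ i≡ j≡ _ _ → at-cong _ _ λ k l k≡ l≡ →
      ≡.subst (λ l → h (k , l) ≡ f (k , l)) (≡.sym (injective l≡ j≡))
        (eq (≡.trans k≡ (≡.sym (ℕ.suc-injective i≡)))))

    ŷ-right : (∀ {l} → toℕ l ≡ suc (toℕ j) → h (i , l) ≡ f (i , l)) →
      ŷ (at h) (suc (toℕ i)) (suc (suc (toℕ j))) ≈ ŷ (at f) (suc (toℕ i)) (suc (suc (toℕ j)))
    ŷ-right eq = ŷ-cong {at h} {at f} (suc (toℕ i)) (suc (suc (toℕ j))) (λ i≡ j≡ _ _ → at-cong _ _ λ k l k≡ l≡ →
      ≡.subst (λ k → h (k , l) ≡ f (k , l)) (≡.sym (injective k≡ i≡))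
        (eq (≡.trans l≡ (≡.sym (ℕ.suc-injective j≡)))))

  toggle-at : ∀ {f g h} i j → g (i , j) ≡ τ (i , j) h (i , j) → h (i , j) ≡ f (i , j) →
    lowSum (at h) (at h) (toℕ i) (toℕ j) * proj₁ (at f (toℕ i) (toℕ j) ⁻¹) ≈
    proj₁ (at g (toℕ i) (toℕ j)) * upSum (at h) (at h) (toℕ i) (toℕ j)
  toggle-at {f} {g} {h} i j gx hx = trans
    (*-congˡ (reflexive (≡.cong (λ s → proj₁ (s ⁻¹)) (≡.trans (at-toℕ f i j) (≡.sym hx)))))
    (trans (toggle h i j) (*-congʳ (reflexive (≡.cong proj₁ (≡.trans (≡.sym gx) (≡.sym (at-toℕ g i j)))))))

  rowmotion-step : ∀ {xs} → IsLinearExtension xs → ∀ f i j → let g = rowmotion xs f in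
    lowSum (at f) (at f) (toℕ i) (toℕ j) * proj₁ (at f (toℕ i) (toℕ j) ⁻¹) ≈
    proj₁ (at g (toℕ i) (toℕ j)) * upSum (at g) (at g) (toℕ i) (toℕ j)
  rowmotion-step {xs} lin f i j with rowmotion-update lin f (i , j)
  ... | h , gx , hx , below , above = trans
    (*-congʳ (sym (+-cong
      (x̂-above f h i j (below ∘ ↗⇒< ∘ ↗₁)) (x̂-left f h i j (below ∘ ↗⇒< ∘ ↗₂)))))
    (trans (toggle-at i j gx hx)
    (*-congˡ (+-cong
      (ŷ-below (rowmotion xs f) h i j (above ∘ ↗⇒< ∘ ↗₁)) (ŷ-right (rowmotion xs f) h i j (above ∘ ↗⇒< ∘ ↗₂)))))

  fileIndex-↗₁ : ∀ {i i′ j} → toℕ i′ ≡ suc (toℕ i) → fileIndex (i′ , j) < fileIndex (i , j)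
  fileIndex-↗₁ {i} {i′} {j} eq = ℕ.+-monoʳ-< (toℕ j)
    (ℕ.∸-monoʳ-< (ℕ.≤-reflexive (≡.sym eq)) (ℕ.<⇒≤ (Fin.toℕ<n i′)))

  fileIndex-↗₂ : ∀ {i j j′} → toℕ j′ ≡ suc (toℕ j) → fileIndex (i , j) < fileIndex (i , j′)
  fileIndex-↗₂ {i} eq = ℕ.+-monoˡ-< (a ∸ toℕ i) (ℕ.≤-reflexive (≡.sym eq))

  -- The file index drops towards the next row and the previous column. Those two neighbours have
  -- already been toggled and are read in `g`, the other two still in `f`.
  promotion-step : ∀ f i j → let g = promotion f in
    lowSum (at f) (at g) (toℕ i) (toℕ j) * proj₁ (at f (toℕ i) (toℕ j) ⁻¹) ≈
    proj₁ (at g (toℕ i) (toℕ j)) * upSum (at g) (at f) (toℕ i) (toℕ j)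
  promotion-step f i j with promotion-update f (i , j)
  ... | h , gx , hx , below , above = trans
    (*-congʳ (sym (+-cong
      (x̂-above f h i j λ {k} eq → below {k , j} (fileIndex-↗₁ {k} {i} {j} eq))
      (x̂-left (promotion f) h i j λ {l} eq → above {i , l} (fileIndex-↗₂ {i} {l} {j} eq)))))
    (trans (toggle-at i j gx hx)
    (*-congˡ (+-cong
      (ŷ-below (promotion f) h i j λ {k} eq → above {k , j} (fileIndex-↗₁ {i} {k} {j} eq))
      (ŷ-right f h i j λ {l} eq → below {i , l} (fileIndex-↗₂ {i} {j} {l} eq)))))

  -- Logarithms and inverses demand elements of `ℝ⁺`, whereas the summands of `lowSum` and `upSum`
  -- may be 0; each border case is therefore spelled out.
  low⁺ up⁺ : Array → Array → Array
  low⁺ F G zero    zero    = 1⁺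
  low⁺ F G zero    (suc j) = G 0 j
  low⁺ F G (suc i) zero    = F i 0
  low⁺ F G (suc i) (suc j) = F i (suc j) +⁺ G (suc i) j
  up⁺ F G i j with suc i ℕ.<? a | suc j ℕ.<? b
  ... | yes _ | yes _ = F (suc i) j ⁻¹ +⁺ G i (suc j) ⁻¹
  ... | yes _ | no  _ = F (suc i) j ⁻¹
  ... | no  _ | yes _ = G i (suc j) ⁻¹
  ... | no  _ | no  _ = 1⁺

  low⁺≈ : ∀ F G i j → proj₁ (low⁺ F G i j) ≈ lowSum F G i j
  low⁺≈ F G zero    zero    = sym (+-identityʳ _)
  low⁺≈ F G zero    (suc j) = sym (+-identityˡ _)
  low⁺≈ F G (suc i) zero    = sym (+-identityʳ _)
  low⁺≈ F G (suc i) (suc j) = refl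

  up⁺≈ : ∀ F G {i j} → i < a → j < b → proj₁ (up⁺ F G i j) ≈ upSum F G i j
  up⁺≈ F G {i} {j} i<a j<b with suc i ℕ.<? a | suc j ℕ.<? b | j ℕ.<? b | i ℕ.<? a
  ... | yes _ | yes _ | yes _ | yes _ = refl
  ... | yes _ | no  _ | yes _ | yes _ = sym (+-identityʳ _)
  ... | no  _ | yes p | yes _ | yes _ = sym (trans (+-congʳ (δ-< p)) (+-identityˡ _))
  ... | no  _ | no ¬p | yes _ | yes _ = sym (trans (+-identityʳ _)
    (trans (reflexive (≡.cong (δ b) (ℕ.≤-antisym j<b (ℕ.≮⇒≥ ¬p)))) (δ-refl b)))
  ... | _     | _     | no ¬q | _     = contradiction j<b ¬q
  ... | _     | _     | yes _ | no ¬p = contradiction i<a ¬p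

  record Orbit : Set (c ⊔ ℓ₁ ⊔ ℓ₂) where
    field
      X      : ℕ → Array
      evolve : ∀ t (i : Fin a) (j : Fin b) →
        lowSum (X t) (X t) (toℕ i) (toℕ j) * proj₁ (X t (toℕ i) (toℕ j) ⁻¹) ≈
        proj₁ (X (suc t) (toℕ i) (toℕ j)) * upSum (X (suc t)) (X (suc t)) (toℕ i) (toℕ j)

    array : RowmotionArray a b
    array = record
      { x         = λ t → x̂ (X t)
      ; y         = λ t → ŷ (X t)
      ; x*y≈1     = λ t {i} {j} p q → trans (*-congˡ (reflexive (ŷ-in p q))) (*-⁻¹ (X t i j))
      ; x-column₀ = λ t i → refl
      ; x-row₀    = λ t j → refl
      ; y-column  = λ t p → reflexive (ŷ-column p)
      ; y-row     = λ t {j} _ → reflexive (ŷ-row j)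
      ; evolve    = λ t p q → ≡.subst₂
          (λ i j → lowSum (X t) (X t) i j * ŷ (X t) (suc i) (suc j) ≈
            proj₁ (X (suc t) i j) * upSum (X (suc t)) (X (suc t)) i j)
          (Fin.toℕ-fromℕ< p) (Fin.toℕ-fromℕ< q)
          (trans (*-congˡ (reflexive (ŷ-in (Fin.toℕ<n _) (Fin.toℕ<n _)))) (evolve t (fromℕ< p) (fromℕ< q)))
      }

    open RowmotionArray array public using (reciprocity; periodic)

  rowmotion-orbit : ∀ {xs} → IsLinearExtension xs → Labeling → Orbit
  rowmotion-orbit {xs} lin f = record
    { X      = λ t → at ((rowmotion xs ^ t) f)
    ; evolve = λ t → rowmotion-step lin ((rowmotion xs ^ t) f)
    }

  -- Delaying column j by b - j steps turns the mixed times of promotion-step into those of rowmotion.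
  promotion-orbit : Labeling → Orbit
  promotion-orbit f = record { X = X ; evolve = evolve }
    where
    X : ℕ → Array
    X t i j = at ((promotion ^ (t ℕ.+ (b ∸ suc j))) f) i j
    later : ∀ t {j} → suc j < b → t ℕ.+ (b ∸ suc j) ≡ suc t ℕ.+ (b ∸ suc (suc j))
    later t {j} p = ≡.trans (≡.cong (t ℕ.+_) (ℕ.+-∸-assoc 1 p)) (ℕ.+-suc t _)
    evolve : ∀ t (i : Fin a) (j : Fin b) → _
    evolve t i j = trans
      (*-congʳ (+-cong
        (x̂-cong {X t} {at g} (toℕ i) (suc (toℕ j)) (λ { _ ≡.refl → refl }))
        (x̂-cong {X t} {at (promotion g)} (suc (toℕ i)) (toℕ j) λ {i′} {j′} _ j≡ →
          reflexive (≡.cong (λ m → proj₁ (at ((promotion ^ m) f) i′ j′))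
            (≡.trans (later t (≡.subst (_< b) j≡ (Fin.toℕ<n j)))
              (≡.cong (λ k → suc t ℕ.+ (b ∸ suc k)) (≡.sym j≡)))))))
      (trans (promotion-step g i j)
      (*-congˡ (+-cong
        (ŷ-cong {at (promotion g)} {X (suc t)} (suc (suc (toℕ i))) (suc (toℕ j)) (λ { _ ≡.refl _ _ → refl }))
        (ŷ-cong {at g} {X (suc t)} (suc (toℕ i)) (suc (suc (toℕ j))) λ { {i′} _ ≡.refl _ q →
          reflexive (≡.cong (λ m → proj₁ (at ((promotion ^ m) f) i′ (suc (toℕ j)))) (later t q)) }))))
      where
      g : Labeling
      g = (promotion ^ (t ℕ.+ (b ∸ suc (toℕ j)))) f

-- Periodicity of promotion

module PromotionPeriodicity {c ℓ₁ ℓ₂} (R : Reals c ℓ₁ ℓ₂) (a b : ℕ) (0<a : 0 < a) where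

  open Reals R hiding (_<_; _≤_)
  open Birational R a b
  open Arrays R a b
  open RowmotionArrays commutativeRing using (inverse-unique)
  open SetoidReasoning setoid

  everywhere : ∀ {f f′} → (∀ i j → i < a → j < b → proj₁ (at f′ i j) ≈ proj₁ (at f i j)) →
    ∀ i j → proj₁ (at f′ i j) ≈ proj₁ (at f i j)
  everywhere eq i j with i ℕ.<? a | j ℕ.<? b | eq i j
  ... | yes p | yes q | eq′ = eq′ p q
  ... | yes _ | no  _ | _   = refl
  ... | no  _ | _     | _   = refl

  private
    *-cancelˡ⁺ : ∀ s {u v} → proj₁ s * u ≈ proj₁ s * v → u ≈ v
    *-cancelˡ⁺ s {u} {v} eq = trans (sym (undo u)) (trans (*-congˡ eq) (undo v))
      where
      undo : ∀ w → proj₁ (s ⁻¹) * (proj₁ s * w) ≈ w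
      undo w = trans (sym (*-assoc _ _ _))
        (trans (*-congʳ (trans (*-comm _ _) (*-⁻¹ s))) (*-identityˡ w))

    ⁻¹-injective : ∀ {s t} → proj₁ (s ⁻¹) ≈ proj₁ (t ⁻¹) → proj₁ s ≈ proj₁ t
    ⁻¹-injective {s} {t} eq = inverse-unique (trans (*-comm _ _) (*-⁻¹ s))
      (trans (*-congʳ eq) (trans (*-comm _ _) (*-⁻¹ t)))

  -- Solved for the old value at a point, `promotion-step` involves only two other old values, those
  -- in the previous row and in the next column. The recursion thus runs on the row and on the
  -- distance `d` to the last column.
  promotion-injective : ∀ f f′ →
    (∀ i j → proj₁ (at (promotion f′) i j) ≈ proj₁ (at (promotion f) i j)) →
    ∀ i j → proj₁ (at f′ i j) ≈ proj₁ (at f i j)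
  promotion-injective f f′ g′≈g = everywhere λ i j i<a j<b →
    back i i<a (b ∸ suc j) (ℕ.m∸n+n≡m j<b)
    where
    g g′ : Labeling
    g  = promotion f
    g′ = promotion f′
    back : ∀ i → i < a → ∀ d {j} → d ℕ.+ suc j ≡ b → proj₁ (at f′ i j) ≈ proj₁ (at f i j)
    back i i<a d {j} d+j = ⁻¹-injective {at f′ i j} {at f i j}
      (*-cancelˡ⁺ (low⁺ (at f) (at g) i j) (begin
        proj₁ (low⁺ (at f) (at g) i j) * proj₁ (at f′ i j ⁻¹)
          ≈⟨ *-congʳ (low⁺≈ (at f) (at g) i j) ⟩
        lowSum (at f) (at g) i j * proj₁ (at f′ i j ⁻¹)
          ≈⟨ *-congʳ (+-cong (lower i i<a) (x̂-cong {at g′} {at g} (suc i) j (λ _ _ → g′≈g _ _))) ⟨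
        lowSum (at f′) (at g′) i j * proj₁ (at f′ i j ⁻¹)
          ≈⟨ step f′ ⟩
        proj₁ (at g′ i j) * upSum (at g′) (at f′) i j
          ≈⟨ *-cong (g′≈g i j) (+-cong (ŷ-cong {at g′} {at g} (suc (suc i)) (suc j) (λ _ _ _ _ → g′≈g _ _)) (upper d d+j)) ⟩
        proj₁ (at g i j) * upSum (at g) (at f) i j
          ≈⟨ step f ⟨
        lowSum (at f) (at g) i j * proj₁ (at f i j ⁻¹)
          ≈⟨ *-congʳ (low⁺≈ (at f) (at g) i j) ⟨
        proj₁ (low⁺ (at f) (at g) i j) * proj₁ (at f i j ⁻¹)  ∎))
      where
      j<b : j < b
      j<b = ℕ.≤-trans (ℕ.m≤n+m (suc j) d) (ℕ.≤-reflexive d+j)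
      step : ∀ f → lowSum (at f) (at (promotion f)) i j * proj₁ (at f i j ⁻¹) ≈
                   proj₁ (at (promotion f) i j) * upSum (at (promotion f)) (at f) i j
      step f = ≡.subst₂
        (λ i j → lowSum (at f) (at (promotion f)) i j * proj₁ (at f i j ⁻¹) ≈
                 proj₁ (at (promotion f) i j) * upSum (at (promotion f)) (at f) i j)
        (Fin.toℕ-fromℕ< i<a) (Fin.toℕ-fromℕ< j<b) (promotion-step f (fromℕ< i<a) (fromℕ< j<b))
      lower : ∀ i → i < a → x̂ (at f′) i (suc j) ≈ x̂ (at f) i (suc j)
      lower zero    _   = refl
      lower (suc i) i<a = back i (ℕ.<-trans (ℕ.n<1+n i) i<a) d d+j
      upper : ∀ d → d ℕ.+ suc j ≡ b → ŷ (at f′) (suc i) (suc (suc j)) ≈ ŷ (at f) (suc i) (suc (suc j))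
      upper zero    ≡.refl = reflexive (≡.trans (ŷ-column i<a) (≡.sym (ŷ-column i<a)))
      upper (suc d) d+j    = ŷ-cong {at f′} {at f} (suc i) (suc (suc j)) λ { ≡.refl ≡.refl _ _ →
        back i i<a d (≡.trans (ℕ.+-suc d (suc j)) d+j) }

  -- The delayed array starts column `j` at time `b ∸ suc j`, so it settles all columns together
  -- only from a later time on (`late`); injectivity removes the surplus `b` steps (`earlier`).
  promotion-periodic : ∀ f m i j →
    proj₁ (at ((promotion ^ (n ℕ.+ m)) f) i j) ≈ proj₁ (at ((promotion ^ m) f) i j)
  promotion-periodic f m = earlier b m (late m)
    where
    Periodic : ℕ → Set _
    Periodic m = ∀ i j → proj₁ (at ((promotion ^ (n ℕ.+ m)) f) i j) ≈ proj₁ (at ((promotion ^ m) f) i j)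
    open Orbit (promotion-orbit f)
    late : ∀ m → Periodic (b ℕ.+ m)
    -- Time `m ℕ.+ suc j` of the array offsets the delay, so that every column shows the labeling at
    -- time `b ℕ.+ m`.
    late m = everywhere λ i j i<a j<b → ≡.subst₂
      (λ k l → proj₁ (at ((promotion ^ k) f) i j) ≈ proj₁ (at ((promotion ^ l) f) i j))
      (≡.trans (ℕ.+-assoc n (m ℕ.+ suc j) _) (≡.cong (n ℕ.+_) (time j<b)))
      (time j<b)
      (periodic 0<a (m ℕ.+ suc j) i<a j<b)
      where
      time : ∀ {j} → j < b → m ℕ.+ suc j ℕ.+ (b ∸ suc j) ≡ b ℕ.+ m
      time {j} j<b = ≡.trans (ℕ.+-assoc m (suc j) _)
        (≡.trans (≡.cong (m ℕ.+_) (ℕ.m+[n∸m]≡n j<b)) (ℕ.+-comm m b))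
    earlier : ∀ d m → Periodic (d ℕ.+ m) → Periodic m
    earlier zero    m per = per
    earlier (suc d) m per = earlier d m (promotion-injective ((promotion ^ (d ℕ.+ m)) f) _ λ i j →
      ≡.subst (λ k → proj₁ (at ((promotion ^ k) f) i j) ≈ proj₁ (at ((promotion ^ suc (d ℕ.+ m)) f) i j))
        (ℕ.+-suc n (d ℕ.+ m)) (per i j))

-- Logarithms and finite sums

module Homomesy {c ℓ₁ ℓ₂} (R : Reals c ℓ₁ ℓ₂)
  (log : PositiveReals.ℝ⁺ R → Reals.Carrier R) (isLog : PositiveReals.IsNaturalLog R log)
  (a b : ℕ) (0<a : 0 < a) (0<b : 0 < b) where

  open Reals R hiding (_<_; _≤_)
  open Birational R a b
  open Functionals log
  open Arrays R a b
  open PromotionPeriodicity R a b 0<a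
  open IsNaturalLog isLog
  open Summation +-commutativeMonoid using (sum; sum-cong-≋; sum-replicate-zero; ∑-distrib-+; ∑-comm)
  open RingProperties ring using (+-cancelʳ)
  open SemiringSummation semiring using (*-distribˡ-sum)
  open RowmotionArrays commutativeRing using (δ; δ-refl)
  open SetoidReasoning setoid
  open SemiringSolver commutativeSemiring using (solve; _:=_; _:+_; _:*_)

  log-1 : log 1⁺ ≈ 0#
  log-1 = +-cancelʳ _ _ _ (begin
    log 1⁺ + log 1⁺   ≈⟨ log-* 1⁺ 1⁺ ⟨
    log (1⁺ *⁺ 1⁺)    ≈⟨ log-cong (*-identityˡ 1#) ⟩
    log 1⁺            ≈⟨ +-identityˡ _ ⟨
    0# + log 1⁺       ∎)

  log-≈1 : ∀ s t → proj₁ s * proj₁ t ≈ 1# → log s + log t ≈ 0#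
  log-≈1 s t eq = trans (sym (log-* s t)) (trans (log-cong eq) log-1)

  ∑-dropˡ : ∀ p {h : ℕ → Carrier} → h 0 ≈ 0# → ∑[ i < suc p ] h (toℕ i) ≈ ∑[ i < p ] h (suc (toℕ i))
  ∑-dropˡ p h₀ = trans (+-congʳ h₀) (+-identityˡ _)

  ∑-last : ∀ p (h : ℕ → Carrier) → ∑[ i < suc p ] h (toℕ i) ≈ ∑[ i < p ] h (toℕ i) + h p
  ∑-last zero    h = +-comm _ _
  ∑-last (suc p) h = trans (+-congˡ (∑-last p (h ∘ suc))) (sym (+-assoc _ _ _))

  ∑-dropʳ : ∀ p {h : ℕ → Carrier} → h p ≈ 0# → ∑[ i < suc p ] h (toℕ i) ≈ ∑[ i < p ] h (toℕ i)
  ∑-dropʳ p {h} hₚ = trans (∑-last p h) (trans (+-congˡ hₚ) (+-identityʳ _))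

  ∑-zeros : ∀ p {h : ℕ → Carrier} → (∀ i → h i ≈ 0#) → ∑[ i < p ] h (toℕ i) ≈ 0#
  ∑-zeros p h₀ = trans (sum-cong-≋ {p} (λ i → h₀ (toℕ i))) (sum-replicate-zero p)

  ∑-shift : ∀ p (h : ℕ → Carrier) → (∀ m → h (p ℕ.+ m) ≈ h m) → ∀ k →
    ∑[ m < p ] h (k ℕ.+ toℕ m) ≈ ∑[ m < p ] h (toℕ m)
  ∑-shift p h per zero    = refl
  ∑-shift p h per (suc k) = trans
    (∑-shift p (h ∘ suc) (λ m → trans (reflexive (≡.cong h (≡.sym (ℕ.+-suc p m)))) (per (suc m))) k)
    (+-cancelʳ _ _ _ (begin
      ∑[ m < p ] h (suc (toℕ m)) + h 0  ≈⟨ +-comm _ _ ⟩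
      ∑[ m < suc p ] h (toℕ m)          ≈⟨ ∑-last p h ⟩
      ∑[ m < p ] h (toℕ m) + h p        ≈⟨ +-congˡ (trans (reflexive (≡.cong h (≡.sym (ℕ.+-identityʳ p)))) (per 0)) ⟩
      ∑[ m < p ] h (toℕ m) + h 0        ∎))

  δ-≢ : ∀ i j → i ≢ j → δ i j ≈ 0#
  δ-≢ zero    zero    i≢j = contradiction ≡.refl i≢j
  δ-≢ zero    (suc j) i≢j = refl
  δ-≢ (suc i) zero    i≢j = refl
  δ-≢ (suc i) (suc j) i≢j = δ-≢ i j (i≢j ∘ ≡.cong suc)

  ∑∑ : ℕ → ℕ → (ℕ → ℕ → Carrier) → Carrier
  ∑∑ p q H = ∑[ i < p ] ∑[ j < q ] H (toℕ i) (toℕ j)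

  ∑∑-cong : ∀ p q G H → (∀ {i j} → i < p → j < q → G i j ≈ H i j) → ∑∑ p q G ≈ ∑∑ p q H
  ∑∑-cong p q G H eq = sum-cong-≋ {p} λ i → sum-cong-≋ {q} λ j → eq (Fin.toℕ<n i) (Fin.toℕ<n j)

  ∑∑-+ : ∀ p q G H → ∑∑ p q (λ i j → G i j + H i j) ≈ ∑∑ p q G + ∑∑ p q H
  ∑∑-+ p q G H = trans
    (sum-cong-≋ {p} λ i → ∑-distrib-+ {q} (λ j → G (toℕ i) (toℕ j)) (λ j → H (toℕ i) (toℕ j)))
    (∑-distrib-+ {p} (λ i → ∑[ j < q ] G (toℕ i) (toℕ j)) (λ i → ∑[ j < q ] H (toℕ i) (toℕ j)))

  -- Sums over files

  inFile : ℕ → ℕ → ℕ → Carrier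
  inFile k i j = δ (suc j ℕ.+ a) (k ℕ.+ suc i)

  -- With an indicator as weight, sums over different files run over the same rectangle, and they
  -- can be reindexed and exchanged with sums over time.
  ∑-file : ℕ → (ℕ → ℕ → Carrier) → Carrier
  ∑-file k G = ∑∑ a b (λ i j → inFile k i j * G i j)

  ∑-file-cong : ∀ k G H → (∀ {i j} → i < a → j < b → G i j ≈ H i j) → ∑-file k G ≈ ∑-file k H
  ∑-file-cong k G H eq = ∑∑-cong a b (λ i j → inFile k i j * G i j) (λ i j → inFile k i j * H i j)
    (λ p q → *-congˡ (eq p q))

  ∑-file-+ : ∀ k G H → ∑-file k (λ i j → G i j + H i j) ≈ ∑-file k G + ∑-file k H
  ∑-file-+ k G H = trans
    (∑∑-cong a b (λ i j → inFile k i j * (G i j + H i j)) (λ i j → inFile k i j * G i j + inFile k i j * H i j)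
      (λ _ _ → distribˡ _ _ _))
    (∑∑-+ a b (λ i j → inFile k i j * G i j) (λ i j → inFile k i j * H i j))

  ∑-file-∑ : ∀ k p (G : ℕ → ℕ → ℕ → Carrier) →
    ∑[ m < p ] ∑-file k (G (toℕ m)) ≈ ∑-file k (λ i j → ∑[ m < p ] G (toℕ m) i j)
  ∑-file-∑ k p G = trans
    (∑-comm {p} {a} (λ m i → ∑[ j < b ] (w i j * G (toℕ m) (toℕ i) (toℕ j))))
    (sum-cong-≋ {a} λ i → trans
      (∑-comm {p} {b} (λ m j → w i j * G (toℕ m) (toℕ i) (toℕ j)))
      (sum-cong-≋ {b} λ j → sym (*-distribˡ-sum {p} (w i j) (λ m → G (toℕ m) (toℕ i) (toℕ j)))))
    where
    w : Fin a → Fin b → Carrier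
    w i j = inFile k (toℕ i) (toℕ j)

  ∑-file-empty : ∀ k G → (∀ {i j} → i < a → j < b → suc j ℕ.+ a ≢ k ℕ.+ suc i) → ∑-file k G ≈ 0#
  ∑-file-empty k G ≢ = trans
    (∑∑-cong a b (λ i j → inFile k i j * G i j) (λ _ _ → 0#)
      (λ p q → trans (*-congʳ (δ-≢ _ _ (≢ p q))) (zeroˡ _)))
    (∑-zeros a {λ _ → ∑[ j < b ] 0#} (λ _ → sum-replicate-zero b))

  ∑-file-0 : ∀ G → ∑-file 0 G ≈ 0#
  ∑-file-0 G = ∑-file-empty 0 G λ {i} {j} i<a _ eq →
    ℕ.<-irrefl ≡.refl (ℕ.≤-trans (ℕ.≤-trans (s≤s (ℕ.m≤n+m a j)) (ℕ.≤-reflexive eq)) i<a)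

  ∑-file-n : ∀ G → ∑-file n G ≈ 0#
  ∑-file-n G = ∑-file-empty n G λ {i} {j} _ j<b eq → ℕ.<-irrefl ≡.refl
    (ℕ.<-≤-trans (ℕ.m<m+n n {suc i} z<s)
      (ℕ.≤-trans (ℕ.≤-reflexive (≡.sym eq))
        (ℕ.≤-trans (ℕ.+-monoˡ-≤ a j<b) (ℕ.≤-reflexive (ℕ.+-comm b a)))))

  -- G is indexed from 0, ext G from 1.
  ext : (ℕ → ℕ → Carrier) → ℕ → ℕ → Carrier
  ext G zero    j       = 0#
  ext G (suc i) zero    = 0#
  ext G (suc i) (suc j) with i ℕ.<? a | j ℕ.<? b
  ... | yes _ | yes _ = G i j
  ... | yes _ | no  _ = 0#
  ... | no  _ | _     = 0#

  ext-in : ∀ {G i j} → i < a → j < b → ext G (suc i) (suc j) ≡ G i j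
  ext-in {i = i} {j} p q with i ℕ.<? a | j ℕ.<? b
  ... | yes _ | yes _ = ≡.refl
  ... | yes _ | no ¬q = contradiction q ¬q
  ... | no ¬p | _     = contradiction p ¬p

  ext-row : ∀ {G} j → ext G (suc a) j ≈ 0#
  ext-row zero = refl
  ext-row (suc j) with a ℕ.<? a
  ... | yes p = contradiction p (ℕ.<-irrefl ≡.refl)
  ... | no  _ = refl

  ext-column : ∀ {G} i → ext G i (suc b) ≈ 0#
  ext-column zero = refl
  ext-column (suc i) with i ℕ.<? a | b ℕ.<? b
  ... | yes _ | yes q = contradiction q (ℕ.<-irrefl ≡.refl)
  ... | yes _ | no  _ = refl
  ... | no  _ | _     = refl

  ext-column₀ : ∀ {G} i → ext G i 0 ≈ 0#
  ext-column₀ zero    = refl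
  ext-column₀ (suc i) = refl

  private
    *0 : ∀ {u v} → v ≈ 0# → u * v ≈ 0#
    *0 v₀ = trans (*-congˡ v₀) (zeroʳ _)

  module Diagonals (k : ℕ) (G : ℕ → ℕ → Carrier) where

    -- Selects the unit squares whose corners (i , j) and (i + 1 , j + 1) lie on file `suc k`; the
    -- other two corners then lie on the files `k` and `suc (suc k)`. With the squares across the
    -- border included, each corner position visits every point of its file once.
    χ : ℕ → ℕ → Carrier
    χ i j = δ (j ℕ.+ a) (suc k ℕ.+ i)

    private
      inner : ∀ (w : ℕ → ℕ → Carrier) k → (∀ i j → w i j ≡ inFile k i j) →
        ∑∑ a b (λ i j → w i j * ext G (suc i) (suc j)) ≈ ∑-file k G
      inner w k w≡ = ∑∑-cong a b (λ i j → w i j * ext G (suc i) (suc j)) (λ i j → inFile k i j * G i j)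
        (λ p q → *-cong (reflexive (w≡ _ _)) (reflexive (ext-in p q)))

      dropˡʳ : ∀ H → (∀ j → H 0 j ≈ 0#) → (∀ i → H i b ≈ 0#) →
        ∑∑ (suc a) (suc b) H ≈ ∑∑ a b (λ i j → H (suc i) j)
      dropˡʳ H row column = trans
        (∑-dropˡ a {λ i → ∑[ j < suc b ] H i (toℕ j)} (∑-zeros (suc b) {H 0} row))
        (sum-cong-≋ {a} λ i → ∑-dropʳ b {H (suc (toℕ i))} (column _))

      dropˡˡ : ∀ H → (∀ j → H 0 j ≈ 0#) → (∀ i → H i 0 ≈ 0#) →
        ∑∑ (suc a) (suc b) H ≈ ∑∑ a b (λ i j → H (suc i) (suc j))
      dropˡˡ H row column = trans
        (∑-dropˡ a {λ i → ∑[ j < suc b ] H i (toℕ j)} (∑-zeros (suc b) {H 0} row))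
        (sum-cong-≋ {a} λ i → ∑-dropˡ b {H (suc (toℕ i))} (column _))

      dropʳˡ : ∀ H → (∀ j → H a j ≈ 0#) → (∀ i → H i 0 ≈ 0#) →
        ∑∑ (suc a) (suc b) H ≈ ∑∑ a b (λ i j → H i (suc j))
      dropʳˡ H row column = trans
        (∑-dropʳ a {λ i → ∑[ j < suc b ] H i (toℕ j)} (∑-zeros (suc b) {H a} row))
        (sum-cong-≋ {a} λ i → ∑-dropˡ b {H (toℕ i)} (column _))

      dropʳʳ : ∀ H → (∀ j → H a j ≈ 0#) → (∀ i → H i b ≈ 0#) →
        ∑∑ (suc a) (suc b) H ≈ ∑∑ a b H
      dropʳʳ H row column = trans
        (∑-dropʳ a {λ i → ∑[ j < suc b ] H i (toℕ j)} (∑-zeros (suc b) {H a} row))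
        (sum-cong-≋ {a} λ i → ∑-dropʳ b {H (toℕ i)} (column _))

    at-ij : ∑∑ (suc a) (suc b) (λ i j → χ i j * ext G i j) ≈ ∑-file (suc k) G
    at-ij = trans
      (dropˡˡ (λ i j → χ i j * ext G i j) (λ _ → zeroʳ _) (λ i → *0 (ext-column₀ {G} i)))
      (inner (λ i j → χ (suc i) (suc j)) (suc k) λ _ _ → ≡.refl)

    at-i+1,j+1 : ∑∑ (suc a) (suc b) (λ i j → χ i j * ext G (suc i) (suc j)) ≈ ∑-file (suc k) G
    at-i+1,j+1 = trans
      (dropʳʳ (λ i j → χ i j * ext G (suc i) (suc j)) (λ j → *0 (ext-row {G} (suc j))) (λ i → *0 (ext-column {G} (suc i))))
      (inner χ (suc k) λ i j → ≡.cong (δ (suc j ℕ.+ a)) (≡.sym (ℕ.+-suc (suc k) i)))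

    at-i+1,j : ∑∑ (suc a) (suc b) (λ i j → χ i j * ext G (suc i) j) ≈ ∑-file k G
    at-i+1,j = trans
      (dropʳˡ (λ i j → χ i j * ext G (suc i) j) (λ j → *0 (ext-row {G} j)) (λ i → zeroʳ _))
      (inner (λ i j → χ i (suc j)) k λ i j → ≡.cong (δ (suc j ℕ.+ a)) (≡.sym (ℕ.+-suc k i)))

    at-i,j+1 : ∑∑ (suc a) (suc b) (λ i j → χ i j * ext G i (suc j)) ≈ ∑-file (suc (suc k)) G
    at-i,j+1 = trans
      (dropˡʳ (λ i j → χ i j * ext G i (suc j)) (λ j → zeroʳ _) (λ i → *0 (ext-column {G} i)))
      (inner (λ i j → χ (suc i) j) (suc (suc k)) λ _ _ → ≡.refl)

  -- Comparing sums and parallel sums along a file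

  logs : Array → ℕ → ℕ → Carrier
  logs F i j = log (F i j)

  -- The elements s and t covering one point are covered by another, so that they enter the parallel
  -- sum of the former and the sum of the latter; s + t = (1 / s + 1 / t) s t compares the two.
  low-up-inner : ∀ F i j → i < a → j < b →
    ext (logs (low⁺ F F)) (suc (suc i)) (suc (suc j)) ≈
    log (up⁺ F F i j) + (ext (logs F) (suc (suc i)) (suc j) + ext (logs F) (suc i) (suc (suc j)))
  low-up-inner F i j i<a j<b with i ℕ.<? a | j ℕ.<? b | suc i ℕ.<? a | suc j ℕ.<? b
  ... | no ¬p | _     | _     | _     = contradiction i<a ¬p
  ... | yes _ | no ¬q | _     | _     = contradiction j<b ¬q
  ... | yes _ | yes _ | yes _ | yes _ = trans (log-cong eq) (trans (log-* _ _) (+-congˡ (log-* s t)))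
    where
    s t : ℝ⁺
    s = F (suc i) j
    t = F i (suc j)
    eq : proj₁ t + proj₁ s ≈ (proj₁ (s ⁻¹) + proj₁ (t ⁻¹)) * (proj₁ s * proj₁ t)
    eq = sym (begin
      (proj₁ (s ⁻¹) + proj₁ (t ⁻¹)) * (proj₁ s * proj₁ t)
        ≈⟨ solve 4 (λ s s′ t t′ → (s′ :+ t′) :* (s :* t) := s :* s′ :* t :+ t :* t′ :* s) refl
             (proj₁ s) (proj₁ (s ⁻¹)) (proj₁ t) (proj₁ (t ⁻¹)) ⟩
      proj₁ s * proj₁ (s ⁻¹) * proj₁ t + proj₁ t * proj₁ (t ⁻¹) * proj₁ s
        ≈⟨ +-cong (trans (*-congʳ (*-⁻¹ s)) (*-identityˡ _)) (trans (*-congʳ (*-⁻¹ t)) (*-identityˡ _)) ⟩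
      proj₁ t + proj₁ s  ∎)
  ... | yes _ | yes _ | yes _ | no  _ = sym (trans (+-congˡ (+-identityʳ _)) (trans (+-comm _ _) (log-≈1 _ _ (*-⁻¹ (F (suc i) j)))))
  ... | yes _ | yes _ | no  _ | yes _ = sym (trans (+-congˡ (+-identityˡ _)) (trans (+-comm _ _) (log-≈1 _ _ (*-⁻¹ (F i (suc j))))))
  ... | yes _ | yes _ | no  _ | no  _ = sym (trans (+-congˡ (+-identityˡ _)) (trans (+-identityʳ _) log-1))

  -- Each of the two excluded squares meets the rectangle in a single corner, which is not on the
  -- diagonal of the square; its logarithm would have no counterpart. At the other border squares a
  -- missing neighbour is missing on both sides.
  low-up : ∀ F i j → ¬ (i ≡ 0 × j ≡ b) → ¬ (i ≡ a × j ≡ 0) → i ≤ a → j ≤ b →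
    ext (logs (low⁺ F F)) (suc i) (suc j) ≈
    ext (logs (up⁺ F F)) i j + (ext (logs F) (suc i) j + ext (logs F) i (suc j))
  low-up F zero zero _ _ _ _ with 0 ℕ.<? a | 0 ℕ.<? b
  ... | yes _ | yes _ = trans log-1 (sym (trans (+-congˡ (+-identityˡ _)) (+-identityˡ _)))
  ... | yes _ | no ¬q = contradiction 0<b ¬q
  ... | no ¬p | _     = contradiction 0<a ¬p
  low-up F zero (suc j) ¬0b _ _ j<b with 0 ℕ.<? a | suc j ℕ.<? b | j ℕ.<? b
  ... | yes _ | yes _ | yes _ = sym (trans (+-identityˡ _) (+-identityʳ _))
  ... | no ¬p | _     | _     = contradiction 0<a ¬p
  ... | _     | no ¬q | _     = contradiction (≡.refl , ℕ.≤-antisym j<b (ℕ.≮⇒≥ ¬q)) ¬0b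
  ... | _     | _     | no ¬q = contradiction j<b ¬q
  low-up F (suc i) zero _ ¬a0 i<a _ with 0 ℕ.<? b | suc i ℕ.<? a | i ℕ.<? a
  ... | yes _ | yes _ | yes _ = sym (trans (+-identityˡ _) (+-identityˡ _))
  ... | no ¬q | _     | _     = contradiction 0<b ¬q
  ... | _     | no ¬p | _     = contradiction (ℕ.≤-antisym i<a (ℕ.≮⇒≥ ¬p) , ≡.refl) ¬a0
  ... | _     | _     | no ¬p = contradiction i<a ¬p
  low-up F (suc i) (suc j) _ _ i<a j<b =
    trans (low-up-inner F i j i<a j<b) (+-congʳ (reflexive (≡.sym (ext-in i<a j<b))))

  file-low-up : ∀ F k → suc k < n →
    ∑-file (suc k) (logs (low⁺ F F)) ≈
    ∑-file (suc k) (logs (up⁺ F F)) + (∑-file k (logs F) + ∑-file (suc (suc k)) (logs F))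
  file-low-up F k k<n = begin
    ∑-file (suc k) S                                         ≈⟨ Diagonals.at-i+1,j+1 k S ⟨
    ∑∑ (suc a) (suc b) (λ i j → χ i j * ext S (suc i) (suc j))
      ≈⟨ ∑∑-cong (suc a) (suc b) (λ i j → χ i j * ext S (suc i) (suc j)) (λ i j → T′ i j + (Z₁ i j + Z₂ i j))
           (λ i<1+a j<1+b → pointwise (s≤s⁻¹ i<1+a) (s≤s⁻¹ j<1+b)) ⟩
    ∑∑ (suc a) (suc b) (λ i j → T′ i j + (Z₁ i j + Z₂ i j))
      ≈⟨ trans (∑∑-+ (suc a) (suc b) T′ (λ i j → Z₁ i j + Z₂ i j)) (+-congˡ (∑∑-+ (suc a) (suc b) Z₁ Z₂)) ⟩
    ∑∑ (suc a) (suc b) T′ + (∑∑ (suc a) (suc b) Z₁ + ∑∑ (suc a) (suc b) Z₂)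
      ≈⟨ +-cong (Diagonals.at-ij k T) (+-cong (Diagonals.at-i+1,j k Z) (Diagonals.at-i,j+1 k Z)) ⟩
    ∑-file (suc k) T + (∑-file k Z + ∑-file (suc (suc k)) Z)  ∎
    where
    S T Z : ℕ → ℕ → Carrier
    S = logs (low⁺ F F)
    T = logs (up⁺ F F)
    Z = logs F
    open Diagonals k Z using (χ)
    T′ Z₁ Z₂ : ℕ → ℕ → Carrier
    T′ i j = χ i j * ext T i j
    Z₁ i j = χ i j * ext Z (suc i) j
    Z₂ i j = χ i j * ext Z i (suc j)
    pointwise : ∀ {i j} → i ≤ a → j ≤ b →
      χ i j * ext S (suc i) (suc j) ≈ χ i j * ext T i j + (χ i j * ext Z (suc i) j + χ i j * ext Z i (suc j))
    pointwise {i} {j} i≤a j≤b with j ℕ.+ a ℕ.≟ suc k ℕ.+ i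
    ... | no  ≢ = trans (kill _) (sym (trans (+-cong (kill _) (trans (+-cong (kill _) (kill _)) (+-identityˡ _))) (+-identityˡ _)))
      where
      kill : ∀ v → χ i j * v ≈ 0#
      kill v = trans (*-congʳ (δ-≢ _ _ ≢)) (zeroˡ v)
    -- The diagonals of the two exceptional squares have the indices n and 0, and `suc k` is
    -- neither.
    ... | yes eq = trans (*-congˡ (low-up F i j
        (λ { (≡.refl , ≡.refl) → ℕ.<-irrefl (≡.trans (≡.sym (ℕ.+-identityʳ (suc k))) (≡.trans (≡.sym eq) (ℕ.+-comm b a))) k<n })
        (λ { (≡.refl , ≡.refl) → ℕ.<-irrefl eq (s≤s (ℕ.m≤n+m a k)) }) i≤a j≤b))
      (trans (distribˡ _ _ _) (+-congˡ (distribˡ _ _ _)))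

  -- Starting from 0, such a sequence is linear, so its final term is a positive multiple of `A 1`.
  -- The multiples of 1 are built in `ℝ⁺`, where positivity supplies the inverse that cancels the
  -- last of them.
  second-difference-vanish : ∀ p (A : ℕ → Carrier) →
    (∀ k → suc k < p → A (suc k) + A (suc k) ≈ A k + A (suc (suc k))) →
    A 0 ≈ 0# → A p ≈ 0# → ∀ {k} → k ≤ p → A k ≈ 0#
  second-difference-vanish zero    A Δ² A₀ Aₚ z≤n     = A₀
  second-difference-vanish (suc p) A Δ² A₀ Aₚ {zero}  _ = A₀
  second-difference-vanish (suc p) A Δ² A₀ Aₚ {suc k} (s≤s k≤p) = begin
    A (suc k)              ≈⟨ linear k (s≤s k≤p) ⟩
    proj₁ (multiple k) * A 1  ≈⟨ *-congˡ A₁≈0 ⟩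
    proj₁ (multiple k) * 0#   ≈⟨ zeroʳ _ ⟩
    0#                     ∎
    where
    multiple : ℕ → ℝ⁺
    multiple zero    = 1⁺
    multiple (suc k) = 1⁺ +⁺ multiple k
    linear : ∀ k → k < suc p → A (suc k) ≈ proj₁ (multiple k) * A 1
    linear zero          _   = sym (*-identityˡ _)
    linear (suc zero)    1<p = trans (sym (trans (Δ² 0 1<p) (trans (+-congʳ A₀) (+-identityˡ _))))
      (sym (trans (distribʳ _ _ _) (+-cong (*-identityˡ _) (*-identityˡ _))))
    linear (suc (suc k)) k<p = +-cancelʳ _ _ _ (begin
      A (suc (suc (suc k))) + A (suc k)
        ≈⟨ trans (+-comm _ _) (sym (Δ² (suc k) k<p)) ⟩
      A (suc (suc k)) + A (suc (suc k))
        ≈⟨ (let ih = linear (suc k) (ℕ.<-trans (ℕ.n<1+n (suc k)) k<p) in +-cong ih ih) ⟩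
      (1# + m) * A 1 + (1# + m) * A 1
        ≈⟨ solve 3 (λ o m x → (o :+ m) :* x :+ (o :+ m) :* x := (o :+ (o :+ m)) :* x :+ m :* x) refl 1# m (A 1) ⟩
      (1# + (1# + m)) * A 1 + m * A 1
        ≈⟨ +-congˡ (linear k (ℕ.<-trans (ℕ.n<1+n k) (ℕ.<-trans (ℕ.n<1+n (suc k)) k<p))) ⟨
      (1# + (1# + m)) * A 1 + A (suc k)  ∎)
      where
      m : Carrier
      m = proj₁ (multiple k)
    A₁≈0 : A 1 ≈ 0#
    A₁≈0 = begin
      A 1                                     ≈⟨ trans (*-congʳ (trans (*-comm _ _) (*-⁻¹ m))) (*-identityˡ _) ⟨
      proj₁ (m ⁻¹) * proj₁ m * A 1            ≈⟨ *-assoc _ _ _ ⟩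
      proj₁ (m ⁻¹) * (proj₁ m * A 1)          ≈⟨ *-congˡ (trans (sym (linear p ℕ.≤-refl)) Aₚ) ⟩
      proj₁ (m ⁻¹) * 0#                       ≈⟨ zeroʳ _ ⟩
      0#                                      ∎
      where
      m : ℝ⁺
      m = multiple p

  rowmotion-periodic : ∀ {xs} → IsLinearExtension xs → ∀ f m i j →
    proj₁ (at ((rowmotion xs ^ (n ℕ.+ m)) f) i j) ≈ proj₁ (at ((rowmotion xs ^ m) f) i j)
  rowmotion-periodic lin f m = everywhere λ i j p q → Orbit.periodic (rowmotion-orbit lin f) 0<a m p q

  -- Sums over a period of the recurrence

  module OrbitSums (O : Orbit) where

    open Orbit O

    log-periodic : ∀ {i j} → i < a → j < b → ∀ t → log (X (n ℕ.+ t) i j) ≈ log (X t i j)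
    log-periodic p q t = log-cong (periodic 0<a t p q)

    antipodal-sum : ∀ (i : Fin a) (j : Fin b) →
      ∑[ t < n ] log (X (toℕ t) (toℕ i) (toℕ j)) +
      ∑[ t < n ] log (X (toℕ t) (toℕ (opposite i)) (toℕ (opposite j))) ≈ 0#
    antipodal-sum i j = begin
      ∑[ t < n ] x (toℕ t) + ∑[ t < n ] x* (toℕ t)
        ≈⟨ +-congʳ (∑-shift n x (log-periodic (Fin.toℕ<n i) (Fin.toℕ<n j)) s) ⟨
      ∑[ t < n ] x (s ℕ.+ toℕ t) + ∑[ t < n ] x* (toℕ t)
        ≈⟨ ∑-distrib-+ {n} (λ t → x (s ℕ.+ toℕ t)) (λ t → x* (toℕ t)) ⟨
      ∑[ t < n ] (x (s ℕ.+ toℕ t) + x* (toℕ t))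
        ≈⟨ ∑-zeros n {λ t → x (s ℕ.+ t) + x* t} (λ t → trans (+-comm _ _) (log-≈1 _ _ (reciprocity 0<a t (opp i) (opp j)))) ⟩
      0#  ∎
      where
      -- The number of steps after which `reciprocity` inverts the antipodal value at (i , j);
      -- starting the first sum `s` steps later pairs the factors.
      s : ℕ
      s = suc (toℕ i ℕ.+ toℕ j)
      x x* : ℕ → Carrier
      x  t = log (X t (toℕ i) (toℕ j))
      x* t = log (X t (toℕ (opposite i)) (toℕ (opposite j)))
      opp : ∀ {m} (i : Fin m) → toℕ i ℕ.+ suc (toℕ (opposite i)) ≡ m
      opp i = ≡.trans (≡.cong (λ k → toℕ i ℕ.+ suc k) (Fin.opposite-prop i))
        (≡.trans (ℕ.+-suc (toℕ i) _) (ℕ.m+[n∸m]≡n (Fin.toℕ<n i)))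

    files : ℕ → Carrier
    files k = ∑[ t < n ] ∑-file k (logs (X (toℕ t)))

    evolve-log : ∀ t {i j} → i < a → j < b →
      logs (X (suc t)) i j + (logs (X t) i j + logs (up⁺ (X (suc t)) (X (suc t))) i j) ≈
      logs (low⁺ (X t) (X t)) i j
    evolve-log t {i} {j} p q = trans (+-congˡ (sym (log-* _ _))) (trans (sym (log-* _ _)) (log-cong (begin
      x′ * (x * proj₁ (up⁺ (X (suc t)) (X (suc t)) i j))  ≈⟨ solve 3 (λ x′ x u → x′ :* (x :* u) := x′ :* u :* x) refl x′ x _ ⟩
      x′ * proj₁ (up⁺ (X (suc t)) (X (suc t)) i j) * x    ≈⟨ *-congʳ (*-congˡ (up⁺≈ (X (suc t)) (X (suc t)) p q)) ⟩
      x′ * upSum (X (suc t)) (X (suc t)) i j * x          ≈⟨ *-congʳ (evolve-ℕ p q) ⟨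
      lowSum (X t) (X t) i j * proj₁ (X t i j ⁻¹) * x     ≈⟨ solve 3 (λ l x y → l :* y :* x := l :* (x :* y)) refl _ x _ ⟩
      lowSum (X t) (X t) i j * (x * proj₁ (X t i j ⁻¹))   ≈⟨ trans (*-congˡ (*-⁻¹ (X t i j))) (*-identityʳ _) ⟩
      lowSum (X t) (X t) i j                              ≈⟨ low⁺≈ (X t) (X t) i j ⟨
      proj₁ (low⁺ (X t) (X t) i j)                        ∎)))
      where
      x x′ : Carrier
      x  = proj₁ (X t i j)
      x′ = proj₁ (X (suc t) i j)
      evolve-ℕ : ∀ {i j} → i < a → j < b → lowSum (X t) (X t) i j * proj₁ (X t i j ⁻¹) ≈
        proj₁ (X (suc t) i j) * upSum (X (suc t)) (X (suc t)) i j
      evolve-ℕ p q = ≡.subst₂ (λ i j → lowSum (X t) (X t) i j * proj₁ (X t i j ⁻¹) ≈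
          proj₁ (X (suc t) i j) * upSum (X (suc t)) (X (suc t)) i j)
        (Fin.toℕ-fromℕ< p) (Fin.toℕ-fromℕ< q) (evolve t (fromℕ< p) (fromℕ< q))

    -- In the logarithm of the recurrence the sums over lower covers are replaced, by `file-low-up`,
    -- with parallel sums of the same time and the two adjacent files. The parallel sums then occur
    -- at time `suc t` on one side and at time `t` on the other, and cancel over a period.
    second-difference : ∀ k → suc k < n → files (suc k) + files (suc k) ≈ files k + files (suc (suc k))
    second-difference k k<n = +-cancelʳ _ _ _ (begin
      files (suc k) + files (suc k) + ∑[ t < n ] T (toℕ t)
        ≈⟨ +-congʳ (+-congʳ (∑-shift n Z Z-periodic 1)) ⟨
      ∑[ t < n ] Z (suc (toℕ t)) + files (suc k) + ∑[ t < n ] T (toℕ t)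
        ≈⟨ trans (+-assoc _ _ _) (+-congˡ (+-congˡ (sym (∑-shift n T T-periodic 1)))) ⟩
      ∑[ t < n ] Z (suc (toℕ t)) + (files (suc k) + ∑[ t < n ] T (suc (toℕ t)))
        ≈⟨ +-congˡ (∑-distrib-+ {n} (Z ∘ toℕ) (T ∘ suc ∘ toℕ)) ⟨
      ∑[ t < n ] Z (suc (toℕ t)) + ∑[ t < n ] (Z (toℕ t) + T (suc (toℕ t)))
        ≈⟨ ∑-distrib-+ {n} (Z ∘ suc ∘ toℕ) (λ t → Z (toℕ t) + T (suc (toℕ t))) ⟨
      ∑[ t < n ] (Z (suc (toℕ t)) + (Z (toℕ t) + T (suc (toℕ t))))
        ≈⟨ sum-cong-≋ {n} (λ t → step (toℕ t)) ⟩
      ∑[ t < n ] (T (toℕ t) + (∑-file k (logs (X (toℕ t))) + ∑-file (suc (suc k)) (logs (X (toℕ t)))))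
        ≈⟨ ∑-distrib-+ {n} (T ∘ toℕ) (λ t → ∑-file k (logs (X (toℕ t))) + ∑-file (suc (suc k)) (logs (X (toℕ t)))) ⟩
      ∑[ t < n ] T (toℕ t) + ∑[ t < n ] (∑-file k (logs (X (toℕ t))) + ∑-file (suc (suc k)) (logs (X (toℕ t))))
        ≈⟨ trans (+-comm _ _) (+-congʳ (∑-distrib-+ {n} (λ t → ∑-file k (logs (X (toℕ t)))) (λ t → ∑-file (suc (suc k)) (logs (X (toℕ t)))))) ⟩
      files k + files (suc (suc k)) + ∑[ t < n ] T (toℕ t)  ∎)
      where
      U : ℕ → ℕ → ℕ → Carrier
      U t = logs (up⁺ (X t) (X t))
      Z T : ℕ → Carrier
      Z t = ∑-file (suc k) (logs (X t))
      T t = ∑-file (suc k) (U t)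
      Z-periodic : ∀ t → Z (n ℕ.+ t) ≈ Z t
      Z-periodic t = ∑-file-cong (suc k) (logs (X (n ℕ.+ t))) (logs (X t)) (λ p q → log-periodic p q t)
      T-periodic : ∀ t → T (n ℕ.+ t) ≈ T t
      T-periodic t = ∑-file-cong (suc k) (U (n ℕ.+ t)) (U t) λ {i} {j} p q →
        log-cong {up⁺ (X (n ℕ.+ t)) (X (n ℕ.+ t)) i j} {up⁺ (X t) (X t) i j}
        (trans (up⁺≈ (X (n ℕ.+ t)) (X (n ℕ.+ t)) p q) (trans
        (+-cong (ŷ-cong {X (n ℕ.+ t)} {X t} (suc (suc i)) (suc j) (λ _ _ p q → periodic 0<a t p q))
                (ŷ-cong {X (n ℕ.+ t)} {X t} (suc i) (suc (suc j)) (λ _ _ p q → periodic 0<a t p q)))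
        (sym (up⁺≈ (X t) (X t) p q))))
      step : ∀ t → Z (suc t) + (Z t + T (suc t)) ≈
        T t + (∑-file k (logs (X t)) + ∑-file (suc (suc k)) (logs (X t)))
      step t = begin
        Z (suc t) + (Z t + T (suc t))
          ≈⟨ trans (∑-file-+ (suc k) (logs (X (suc t))) V) (+-congˡ (∑-file-+ (suc k) (logs (X t)) (U (suc t)))) ⟨
        ∑-file (suc k) (λ i j → logs (X (suc t)) i j + V i j)
          ≈⟨ ∑-file-cong (suc k) (λ i j → logs (X (suc t)) i j + V i j) (logs (low⁺ (X t) (X t))) (evolve-log t) ⟩
        ∑-file (suc k) (logs (low⁺ (X t) (X t)))
          ≈⟨ file-low-up (X t) k k<n ⟩
        T t + (∑-file k (logs (X t)) + ∑-file (suc (suc k)) (logs (X t)))  ∎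
        where
        V : ℕ → ℕ → Carrier
        V i j = logs (X t) i j + U (suc t) i j

    files-0 : files 0 ≈ 0#
    files-0 = ∑-zeros n {λ t → ∑-file 0 (logs (X t))} (λ t → ∑-file-0 (logs (X t)))

    files-n : files n ≈ 0#
    files-n = ∑-zeros n {λ t → ∑-file n (logs (X t))} (λ t → ∑-file-n (logs (X t)))

    files-0≈ : ∀ {k} → k ≤ n → files k ≈ 0#
    files-0≈ = second-difference-vanish n files second-difference files-0 files-n

  -- Transfer to the functionals

  module _ {A : Set} where

    ∑ₗ-++ : ∀ (e : A → Carrier) zs {ws} → ∑ₗ e (zs ++ ws) ≈ ∑ₗ e zs + ∑ₗ e ws
    ∑ₗ-++ e []       = sym (+-identityˡ _)
    ∑ₗ-++ e (z ∷ zs) = trans (+-congˡ (∑ₗ-++ e zs)) (sym (+-assoc _ _ _))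

    ∑ₗ-map-tabulate : ∀ {B : Set} {p} (e : A → Carrier) (g : B → A) (h : Fin p → B) →
      ∑ₗ e (List.map g (tabulate h)) ≈ ∑[ i < p ] e (g (h i))
    ∑ₗ-map-tabulate {p = zero}  e g h = refl
    ∑ₗ-map-tabulate {p = suc p} e g h = +-congˡ (∑ₗ-map-tabulate e g (h ∘ Fin.suc))

    ∑ₗ-filter : ∀ {Q : Pred A Level.zero} (Q? : Decidable Q) (w e : A → Carrier) →
      (∀ {z} → Q z → w z ≈ 1#) → (∀ {z} → ¬ Q z → w z ≈ 0#) →
      ∀ zs → ∑ₗ e (filter Q? zs) ≈ ∑ₗ (λ z → w z * e z) zs
    ∑ₗ-filter Q? w e w≈1 w≈0 []       = refl
    ∑ₗ-filter Q? w e w≈1 w≈0 (z ∷ zs) with Q? z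
    ... | yes q = +-cong (sym (trans (*-congʳ (w≈1 q)) (*-identityˡ _))) (∑ₗ-filter Q? w e w≈1 w≈0 zs)
    ... | no ¬q = trans (∑ₗ-filter Q? w e w≈1 w≈0 zs)
      (sym (trans (+-congʳ (trans (*-congʳ (w≈0 ¬q)) (zeroˡ _))) (+-identityˡ _)))

    log-∏⁺ : ∀ (f : A → ℝ⁺) zs → log (∏⁺ (List.map f zs)) ≈ ∑ₗ (λ z → log (f z)) zs
    log-∏⁺ f []       = log-1
    log-∏⁺ f (z ∷ zs) = trans (log-* _ _) (+-congˡ (log-∏⁺ f zs))

  ∑ₗ-product : ∀ {A B : Set} {p q} (e : A × B → Carrier) (g : Fin p → A) (h : Fin q → B) →
    ∑ₗ e (cartesianProduct (tabulate g) (tabulate h)) ≈ ∑[ i < p ] ∑[ j < q ] e (g i , h j)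
  ∑ₗ-product {p = zero}  e g h = refl
  ∑ₗ-product {p = suc p} e g h = trans
    (∑ₗ-++ e (List.map (g Fin.zero ,_) (tabulate h)))
    (+-cong (∑ₗ-map-tabulate e (g Fin.zero ,_) h) (∑ₗ-product e (g ∘ Fin.suc) h))

  F-file≈∑-file : ∀ k f → F-file k f ≈ ∑-file k (logs (at f))
  F-file≈∑-file k f = begin
    log (∏⁺ (List.map f (file k)))
      ≈⟨ log-∏⁺ f (file k) ⟩
    ∑ₗ (λ x → log (f x)) (file k)
      ≈⟨ ∑ₗ-filter (λ (i , j) → suc (toℕ j) ℕ.+ a ℕ.≟ k ℕ.+ suc (toℕ i)) w (λ x → log (f x))
           (λ { {i , j} eq → trans (reflexive (≡.cong (λ m → δ m (k ℕ.+ suc (toℕ i))) eq)) (δ-refl (k ℕ.+ suc (toℕ i))) }) (λ ≢ → δ-≢ _ _ ≢) elements ⟩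
    ∑ₗ (λ x → w x * log (f x)) elements
      ≈⟨ ∑ₗ-product (λ x → w x * log (f x)) id id ⟩
    ∑[ i < a ] ∑[ j < b ] (w (i , j) * log (f (i , j)))
      ≈⟨ (sum-cong-≋ {a} λ i → sum-cong-≋ {b} λ j → *-congˡ (reflexive (≡.cong log (≡.sym (at-toℕ f i j))))) ⟩
    ∑-file k (logs (at f))  ∎
    where
    w : P → Carrier
    w (i , j) = inFile k (toℕ i) (toℕ j)

  module _ {T : Endo} {f : Labeling} (O : Orbit) (s : ℕ → ℕ)
    (X≡ : ∀ t i j → Orbit.X O t i j ≡ at ((T ^ (s j ℕ.+ t)) f) i j)
    (T-periodic : ∀ m i j → proj₁ (at ((T ^ (n ℕ.+ m)) f) i j) ≈ proj₁ (at ((T ^ m) f) i j)) where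

    open Orbit O using (X)
    open OrbitSums O

    private
      -- The delay `s j` of a column only moves the start of the sum, and over a full period the
      -- start is immaterial.
      ∑-X : ∀ i j → ∑[ m < n ] log (at ((T ^ toℕ m) f) i j) ≈ ∑[ t < n ] log (X (toℕ t) i j)
      ∑-X i j = sym (trans
        (sum-cong-≋ {n} λ t → reflexive (≡.cong log (X≡ (toℕ t) i j)))
        (∑-shift n (λ m → log (at ((T ^ m) f) i j)) (λ m → log-cong (T-periodic m i j)) (s j)))

    antipodal-mesic : ∀ i j → ∑[ m < n ] F-antipodal i j ((T ^ toℕ m) f) ≈ 0#
    antipodal-mesic i j = begin
      ∑[ m < n ] F-antipodal i j ((T ^ toℕ m) f)
        ≈⟨ sum-cong-≋ {n} (λ m → trans (log-* _ _) (+-cong (value m i j) (value m (opposite i) (opposite j)))) ⟩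
      ∑[ m < n ] (ℓ i j m + ℓ (opposite i) (opposite j) m)
        ≈⟨ ∑-distrib-+ {n} (ℓ i j) (ℓ (opposite i) (opposite j)) ⟩
      ∑[ m < n ] ℓ i j m + ∑[ m < n ] ℓ (opposite i) (opposite j) m
        ≈⟨ +-cong (∑-X (toℕ i) (toℕ j)) (∑-X (toℕ (opposite i)) (toℕ (opposite j))) ⟩
      ∑[ t < n ] log (X (toℕ t) (toℕ i) (toℕ j)) +
      ∑[ t < n ] log (X (toℕ t) (toℕ (opposite i)) (toℕ (opposite j)))
        ≈⟨ antipodal-sum i j ⟩
      0#  ∎
      where
      ℓ : Fin a → Fin b → Fin n → Carrier
      ℓ i j m = log (at ((T ^ toℕ m) f) (toℕ i) (toℕ j))
      value : ∀ m i j → log ((T ^ toℕ m) f (i , j)) ≈ ℓ i j m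
      value m i j = reflexive (≡.cong log (≡.sym (at-toℕ ((T ^ toℕ m) f) i j)))

    file-mesic : ∀ k → k ≤ n → ∑[ m < n ] F-file k ((T ^ toℕ m) f) ≈ 0#
    file-mesic k k≤n = begin
      ∑[ m < n ] F-file k ((T ^ toℕ m) f)
        ≈⟨ sum-cong-≋ {n} (λ m → F-file≈∑-file k ((T ^ toℕ m) f)) ⟩
      ∑[ m < n ] ∑-file k (logs (at ((T ^ toℕ m) f)))
        -- The sum over time goes inside, because the delay varies along the file and can be undone
        -- only for one entry at a time.
        ≈⟨ ∑-file-∑ k n (λ m → logs (at ((T ^ m) f))) ⟩
      ∑-file k (λ i j → ∑[ m < n ] log (at ((T ^ toℕ m) f) i j))
        ≈⟨ ∑-file-cong k (λ i j → ∑[ m < n ] log (at ((T ^ toℕ m) f) i j)) (λ i j → ∑[ t < n ] log (X (toℕ t) i j))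
             (λ {i} {j} _ _ → ∑-X i j) ⟩
      ∑-file k (λ i j → ∑[ t < n ] log (X (toℕ t) i j))
        ≈⟨ ∑-file-∑ k n (λ t → logs (X t)) ⟨
      files k
        ≈⟨ files-0≈ k≤n ⟩
      0#  ∎

  module _ {xs} (lin : IsLinearExtension xs) where

    rowmotion-antipodal : ∀ i j → ZeroMesic (rowmotion xs) (F-antipodal i j)
    rowmotion-antipodal i j f =
      antipodal-mesic {rowmotion xs} {f} (rowmotion-orbit lin f) (λ _ → 0) (λ _ _ _ → ≡.refl) (rowmotion-periodic lin f) i j

    rowmotion-file : ∀ k → k ≤ n → ZeroMesic (rowmotion xs) (F-file k)
    rowmotion-file k k≤n f =
      file-mesic {rowmotion xs} {f} (rowmotion-orbit lin f) (λ _ → 0) (λ _ _ _ → ≡.refl) (rowmotion-periodic lin f) k k≤n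

  private
    promotion-X : ∀ f t i j → Orbit.X (promotion-orbit f) t i j ≡ at ((promotion ^ (b ∸ suc j ℕ.+ t)) f) i j
    promotion-X f t i j = ≡.cong (λ m → at ((promotion ^ m) f) i j) (ℕ.+-comm t (b ∸ suc j))

  promotion-antipodal : ∀ i j → ZeroMesic promotion (F-antipodal i j)
  promotion-antipodal i j f = antipodal-mesic {promotion} {f} (promotion-orbit f) (λ j → b ∸ suc j)
    (promotion-X f) (promotion-periodic f) i j

  promotion-file : ∀ k → k ≤ n → ZeroMesic promotion (F-file k)
  promotion-file k k≤n f = file-mesic {promotion} {f} (promotion-orbit f) (λ j → b ∸ suc j)
    (promotion-X f) (promotion-periodic f) k k≤n

open import Data.Nat.Base using (_+_)

theorem9 : ∀ {c ℓ₁ ℓ₂} (R : Reals c ℓ₁ ℓ₂)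
    (log : PositiveReals.ℝ⁺ R → Reals.Carrier R) → PositiveReals.IsNaturalLog R log →
    (a b : ℕ) → 1 ≤ a → 1 ≤ b →
    let open Birational R a b
        open Functionals log
    in
    (∀ i j →
      (∀ xs → IsLinearExtension xs → ZeroMesic (rowmotion xs) (F-antipodal i j)) ×
      ZeroMesic promotion (F-antipodal i j)) ×
    (∀ k → 1 ≤ k → k ≤ a + b ∸ 1 →
      (∀ xs → IsLinearExtension xs → ZeroMesic (rowmotion xs) (F-file k)) ×
      ZeroMesic promotion (F-file k))
theorem9 R log isLog a b 1≤a 1≤b =
  (λ i j → (λ xs lin → rowmotion-antipodal lin i j) , promotion-antipodal i j) ,
  (λ k _ k≤ → let k≤n = ℕ.≤-trans k≤ (ℕ.m∸n≤m (a + b) 1) in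
    (λ xs lin → rowmotion-file lin k k≤n) , promotion-file k k≤n)
  where open Homomesy R log isLog a b 1≤a 1≤b
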